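{- Let $n\ge0$ and let $\sigma,\tau\in\mathrm{Typ}(n)$ be types of $n$. The coefficient of $E_\tau$ in the expansion of $E^+_\sigma$ in the basis $\{E_\rho:\rho\in\mathrm{Typ}(n)\}$ is $$\sum_{T\in \mathcal{PT}_E^{\mathrm{doub}}(\sigma, \tau)} (-1)^{\ell_1(T)}.$$
   Context: A type of $n$ is a sequence $\tau=(\tau|^1,\tau|^2,\dots)$ of (possibly empty) integer partitions with $\sum_{i\ge1} i\,|\tau|^i|=n$, where $|\tau|^i|$ is the size of the partition $\tau|^i$; $\mathrm{Typ}(n)$ is the set of types of $n$. Each part $d$ of $\tau|^r$ gives a block $d^r$ of $\tau$ (degree $d$, multiplicity $r$; not exponentiation); a type is thus a multiset of blocks. Let $x_{i,j}$ ($i,j\ge 1$) be indeterminates with $\deg x_{i,j}=i$; all series have rational coefficients. A monomial is square-free if every exponent is at most $1$. $E^+_d$ is the sum of all square-free monomials of degree $d$; $E_d$ is the sum over square-free monomials $f$ of degree $d$ of $(-1)^{m(f)}f$, where $m(f)$ is the number of indeterminates in $f$. For $F\in\{E,E^+\}$, $F_{d^r}$ is obtained from $F_d$ by replacing each $x_{i,j}$ by $x_{i,j}^r$, and $F_\tau=\prod F_{d^r}$ over all blocks $d^r$ of $\tau$ (counted with repetition; empty product $=1$). It is known that $\{F_\tau\}_{\tau\in\mathrm{Typ}(n)}$ is, for each such $F$, a $\mathbb{Q}$-basis of the space $\mathrm{PSym}(n)$ of polysymmetric functions of degree $n$ (power series homogeneous of degree $n$ that are symmetric separately in each variable set $\{x_{i,j}\}_{j\ge1}$).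 The diagram of a partition $\lambda$ has left-justified rows of $\lambda_1,\lambda_2,\dots$ cells; the tensor diagram of $\sigma$ is the sequence of diagrams of $\sigma|^1,\sigma|^2,\dots$, the $i$th one being called the $i$th tensor factor. A brick is a nonempty set of consecutive cells in one row; its length is its number of cells. A doublebrick is a brick of even length marked with a $+$ sign (and is distinguished from unmarked bricks, simply called bricks). A double polybrick tabloid of shape $\sigma$ and content $\tau$ is a decomposition of the tensor diagram of $\sigma$ into disjoint bricks and doublebricks such that, in each row, all doublebricks appear to the right of all bricks, and such that $\tau$ is the multiset of blocks obtained by taking a block $a^m$ for each brick of length $a$ in the $m$th tensor factor and a block $b^{2m}$ for each doublebrick of length $2b$ in the $m$th tensor factor. $\mathcal{PT}_E^{\mathrm{doub}}(\sigma,\tau)$ is the set of double polybrick tabloids of shape $\sigma$ and content $\tau$ with at most one doublebrick in each row. For such $T$, $\ell_1(T)$ is the number of (unmarked) bricks in $T$. -}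

module Defs where

open import Data.Bool.Base using (if_then_else_)
open import Data.Empty using (⊥)
open import Data.Irrelevant using ([_])
open import Data.List.Base using (List; []; _∷_; _++_; map; concat; concatMap; filter; foldr; length; upTo; cartesianProductWith)
open import Data.List.Membership.Propositional using (_∈_)
open import Data.List.Membership.Propositional.Properties using (∈-∃++; ∈-cartesianProductWith⁺; ∈-cartesianProductWith⁻; ∈-filter⁺; ∈-map⁺; ∈-upTo⁺)
open import Data.List.Properties using (∷-injective)
open import Data.List.Relation.Binary.Permutation.Propositional using (_↭_; ↭-refl; ↭-sym; ↭-trans; prep)
open import Data.List.Relation.Binary.Permutation.Propositional.Properties using (∈-resp-↭; ↭-empty-inv; drop-∷; shift)
import Data.List.Membership.DecPropositional as DecMembership
open import Data.List.Relation.Unary.All as All using (All; []; _∷_)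
open import Data.List.Relation.Unary.AllPairs using ([]; _∷_)
open import Data.List.Relation.Unary.Any using (here; there)
open import Data.List.Relation.Unary.Linked as Linked using (Linked)
open import Data.List.Relation.Unary.Unique.Propositional using (Unique)
import Data.List.Relation.Unary.Unique.Propositional.Properties as Unique
open import Data.Nat.Base using (ℕ; zero; suc; _+_; _*_; _≤_; _≥_; s≤s; NonZero)
open import Data.Nat.Divisibility using (_∣?_; quotient)
open import Data.Nat.Properties using (_≟_; _≤?_; _≥?_; nonZero?; ≤-refl; ≤-trans; ≤-reflexive; +-mono-≤; m≤m+n; m≤n+m; m≤n*m; suc-injective)
open import Data.Nat.ListAction using (sum)
open import Data.Product.Base using (∃-syntax; _×_; _,_; proj₁; proj₂; map₁)
open import Data.Rational.Base as ℚ using (ℚ; 0ℚ; 1ℚ)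
open import Data.Refinement.Base using (Refinement-syntax; value; _,_)
import Data.Vec.Properties as Vec using (∷-injective)
open import Data.Vec.Base as Vec using (Vec; []; _∷_; toList)
open import Function.Base using (_∘_)
open import Relation.Binary.Definitions using (DecidableEquality)
open import Relation.Binary.PropositionalEquality using (_≡_; refl; sym; cong; cong₂; subst)
open import Relation.Nullary using (Dec; yes; no; does; recompute; contradiction; contradiction-irr)
open import Relation.Nullary.Decidable using (map′; _×-dec_)
open import Relation.Unary using (Decidable)

listsUpTo : {A : Set} → ℕ → List A → List (List A)
listsUpTo zero    xs = [] ∷ []
listsUpTo (suc k) xs = [] ∷ cartesianProductWith _∷_ xs (listsUpTo k xs)

vecs : {A : Set} (k : ℕ) → List A → List (Vec A k)
vecs zero    xs = [] ∷ []
vecs (suc k) xs = cartesianProductWith _∷_ xs (vecs k xs)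

alls : {A : Set} {P : A → Set} → (∀ x → List (P x)) → (xs : List A) → List (All P xs)
alls f []       = [] ∷ []
alls f (x ∷ xs) = cartesianProductWith _∷_ (f x) (alls f xs)

select : {A : Set} {P : A → Set} → Decidable P → List A → List [ x ∈ A ∣ P x ]
select P? [] = []
select P? (x ∷ xs) with P? x
... | yes p = (x , [ p ]) ∷ select P? xs
... | no  _ = select P? xs

size : List ℕ → ℕ
size = sum

IsPartition : List ℕ → Set
IsPartition λs = All NonZero λs × Linked _≥_ λs

isPartition? : Decidable IsPartition
isPartition? λs = All.all? nonZero? λs ×-dec Linked.linked? _≥?_ λs

Partition : Set
Partition = [ λs ∈ List ℕ ∣ IsPartition λs ]

parts : Partition → List ℕ
parts = value

-- weightFrom i (λ ∷ μ ∷ …) = i |λ| + (i + 1) |μ| + …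
weightFrom : ℕ → List Partition → ℕ
weightFrom i []       = 0
weightFrom i (p ∷ ps) = i * size (parts p) + weightFrom (suc i) ps

-- If Σ i |τ|ⁱ| = n, then τ|ⁱ is empty for i > n, so only the components
-- τ|¹, …, τ|ⁿ are recorded.
Typ : ℕ → Set
Typ n = [ τ ∈ Vec Partition n ∣ weightFrom 1 (toList τ) ≡ n ]

factors : ∀ {n} → Typ n → List Partition
factors τ = toList (value τ)

-- d ↑ r is the block of degree d and multiplicity r.
infix 8 _↑_
record Block : Set where
  constructor _↑_
  field
    degree       : ℕ
    multiplicity : ℕ

blocksFrom : ℕ → List Partition → List Block
blocksFrom r []       = []
blocksFrom r (p ∷ ps) = map (_↑ r) (parts p) ++ blocksFrom (suc r) ps

-- A multiset is a list considered up to _↭_.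
blocks : ∀ {n} → Typ n → List Block
blocks τ = blocksFrom 1 (factors τ)

positiveLists : ℕ → List (List ℕ)
positiveLists n = listsUpTo n (map suc (upTo n))

-- partitions of size at most n
partitions : ℕ → List Partition
partitions n = select isPartition? (filter (λ l → size l ≤? n) (positiveLists n))

-- Complete and repetition-free by types-complete and types-unique.
types : (n : ℕ) → List (Typ n)
types n = select (λ τ → weightFrom 1 (toList τ) ≟ n) (vecs n (partitions n))

-- Row i (counting from 1) of a monomial lists the exponents of
-- x_{i,1}, x_{i,2}, …; missing entries are exponents 0.  Lists that differ
-- only by trailing zeros or trailing all-zero rows denote the same
-- monomial; all the series below agree on such lists.
Monomial : Set
Monomial = List (List ℕ)

-- A series is given by its coefficients.
Series : Set
Series = Monomial → ℚ

infix 4 _≈_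
_≈_ : Series → Series → Set
F ≈ G = ∀ m → F m ≡ G m

∑ : {A : Set} → List A → (A → ℚ) → ℚ
∑ xs f = foldr (λ x q → f x ℚ.+ q) 0ℚ xs

[-1]^_ : ℕ → ℚ
[-1]^ zero  = 1ℚ
[-1]^ suc k = ℚ.- ([-1]^ k)

degreeFrom : ℕ → Monomial → ℕ
degreeFrom i []       = 0
degreeFrom i (r ∷ rs) = i * sum r + degreeFrom (suc i) rs

deg : Monomial → ℕ
deg = degreeFrom 1

-- number of indeterminates that occur
numVars : Monomial → ℕ
numVars m = length (filter nonZero? (concat m))

SquareFree : Monomial → Set
SquareFree = All (All (_≤ 1))

squareFree? : Decidable SquareFree
squareFree? = All.all? (All.all? (_≤? 1))

E⁺ : ℕ → Series
E⁺ d m = if does (squareFree? m ×-dec (deg m ≟ d)) then 1ℚ else 0ℚ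

E : ℕ → Series
E d m = if does (squareFree? m ×-dec (deg m ≟ d)) then [-1]^ numVars m else 0ℚ

-- F with every indeterminate replaced by its r-th power (r ≥ 1): the
-- coefficient of fʳ is that of f in F, and other monomials do not occur.
substPower : ℕ → Series → Series
substPower r F m with All.all? (All.all? (r ∣?_)) m
... | yes r∣m = F (All.reduce (All.reduce quotient) r∣m)
... | no  _   = 0ℚ

splitsℕ : ℕ → List (ℕ × ℕ)
splitsℕ zero    = (0 , 0) ∷ []
splitsℕ (suc e) = (0 , suc e) ∷ map (map₁ suc) (splitsℕ e)

splitsList : {A : Set} → (A → List (A × A)) → List A → List (List A × List A)
splitsList s []       = ([] , []) ∷ []
splitsList s (x ∷ xs) = cartesianProductWith (λ (a , b) (as , bs) → a ∷ as , b ∷ bs) (s x) (splitsList s xs)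

-- all pairs (f , g) of monomials with f g = m
splits : Monomial → List (Monomial × Monomial)
splits = splitsList (splitsList splitsℕ)

one : Series
one m = if does (All.all? (All.all? (_≟ 0)) m) then 1ℚ else 0ℚ

infixr 7 _⊛_
_⊛_ : Series → Series → Series
(F ⊛ G) m = ∑ (splits m) λ (f , g) → F f ℚ.* G g

blockSeries : (ℕ → Series) → Block → Series
blockSeries F (d ↑ r) = substPower r (F d)

typeSeries : ∀ {n} → (ℕ → Series) → Typ n → Series
typeSeries F τ = foldr (λ b G → blockSeries F b ⊛ G) one (blocks τ)

linearCombination : ∀ {n} → (Typ n → ℚ) → (Typ n → Series) → Series
linearCombination {n} c B m = ∑ (types n) λ ρ → c ρ ℚ.* B ρ m

-- F has an expansion in the family B, and in every such expansion the
-- coefficient of B τ is q.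
IsCoefficient : ∀ {n} → (Typ n → Series) → Typ n → Series → ℚ → Set
IsCoefficient B τ F q =
  (∃[ c ] F ≈ linearCombination c B) ×
  (∀ c → F ≈ linearCombination c B → c τ ≡ q)

-- A decomposition of a row into sets of consecutive cells is determined by
-- the lengths read from left to right.  Since doublebricks lie to the right
-- of bricks, it is given by the list of brick lengths followed by the list of
-- half-lengths b of the doublebricks (a doublebrick has 2b cells).
record Row : Set where
  constructor row
  field
    bricks       : List ℕ
    doublebricks : List ℕ
open Row

Covers : ℕ → Row → Set
Covers d ρ = (All NonZero (bricks ρ) × All NonZero (doublebricks ρ)) × sum (bricks ρ) + 2 * sum (doublebricks ρ) ≡ d

covers? : ∀ d → Decidable (Covers d)
covers? d ρ = (All.all? nonZero? (bricks ρ) ×-dec All.all? nonZero? (doublebricks ρ)) ×-dec (sum (bricks ρ) + 2 * sum (doublebricks ρ) ≟ d)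

-- decompositions of a row of d cells
RowTiling : ℕ → Set
RowTiling d = [ ρ ∈ Row ∣ Covers d ρ ]

FactorTiling : Partition → Set
FactorTiling p = All RowTiling (parts p)

Tabloid : ∀ {n} → Typ n → Set
Tabloid σ = All FactorTiling (factors σ)

rows : ∀ {p} → FactorTiling p → List Row
rows = All.reduce value

rowContent : ℕ → Row → List Block
rowContent m ρ = map (_↑ m) (bricks ρ) ++ map (_↑ (2 * m)) (doublebricks ρ)

contentFrom : ℕ → ∀ {ps} → All FactorTiling ps → List Block
contentFrom m []       = []
contentFrom m (_∷_ {p} t ts) = concatMap (rowContent m) (rows {p} t) ++ contentFrom (suc m) ts

content : ∀ {n} (σ : Typ n) → Tabloid σ → List Block
content σ T = contentFrom 1 T

allRows : ∀ {n} (σ : Typ n) → Tabloid σ → List Row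
allRows σ T = concat (All.reduce (λ {p} → rows {p}) T)

ℓ₁ : ∀ {n} (σ : Typ n) → Tabloid σ → ℕ
ℓ₁ σ T = sum (map (length ∘ bricks) (allRows σ T))

AtMostOneDouble : Row → Set
AtMostOneDouble ρ = length (doublebricks ρ) ≤ 1

-- The condition cutting out PT_E^doub(σ,τ) among the tabloids of shape σ.
InPTdoub : ∀ {n} (σ τ : Typ n) → Tabloid σ → Set
InPTdoub σ τ T = All AtMostOneDouble (allRows σ T) × content σ T ↭ blocks τ

_≟ᵇ_ : DecidableEquality Block
(d ↑ r) ≟ᵇ (e ↑ s) = map′ (λ (p , q) → cong₂ _↑_ p q) (λ { refl → refl , refl }) ((d ≟ e) ×-dec (r ≟ s))

_↭?_ : (xs ys : List Block) → Dec (xs ↭ ys)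
[]       ↭? []       = yes ↭-refl
[]       ↭? (y ∷ ys) = no λ p → contradiction (↭-empty-inv (↭-sym p)) λ ()
(x ∷ xs) ↭? ys with DecMembership._∈?_ _≟ᵇ_ x ys
... | no  x∉ys = no λ p → x∉ys (∈-resp-↭ p (here refl))
... | yes x∈ys with ∈-∃++ x∈ys
...   | as , bs , refl = map′ (λ p → ↭-trans (prep x p) (↭-sym (shift x as bs)))
                              (λ p → drop-∷ (↭-trans p (shift x as bs)))
                              (xs ↭? (as ++ bs))

inPTdoub? : ∀ {n} (σ τ : Typ n) → Decidable (InPTdoub σ τ)
inPTdoub? σ τ T = All.all? (λ ρ → length (doublebricks ρ) ≤? 1) (allRows σ T) ×-dec (content σ T ↭? blocks τ)

rowTilings : ∀ d → List (RowTiling d)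
rowTilings d = select (covers? d) (cartesianProductWith row (positiveLists d) (positiveLists d))

tabloids : ∀ {n} (σ : Typ n) → List (Tabloid σ)
tabloids σ = alls (λ p → alls rowTilings (parts p)) (factors σ)

-- Complete and repetition-free by tabloids-complete and tabloids-unique.
PTdoub : ∀ {n} (σ τ : Typ n) → List (Tabloid σ)
PTdoub σ τ = filter (inPTdoub? σ τ) (tabloids σ)

∈-listsUpTo : ∀ {A : Set} {xs : List A} {k l} → All (_∈ xs) l → length l ≤ k → l ∈ listsUpTo k xs
∈-listsUpTo {k = zero}  []       _         = here refl
∈-listsUpTo {k = suc k} []       _         = here refl
∈-listsUpTo {k = suc k} (p ∷ ps) (s≤s l≤k) = there (∈-cartesianProductWith⁺ _∷_ p (∈-listsUpTo ps l≤k))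

∈-vecs : ∀ {A : Set} {xs : List A} {k} (v : Vec A k) → All (_∈ xs) (toList v) → v ∈ vecs k xs
∈-vecs []      []       = here refl
∈-vecs (_ ∷ v) (p ∷ ps) = ∈-cartesianProductWith⁺ _∷_ p (∈-vecs v ps)

∈-alls : ∀ {A : Set} {P : A → Set} {f : ∀ x → List (P x)} → (∀ x (p : P x) → p ∈ f x) →
         ∀ {xs} (ps : All P xs) → ps ∈ alls f xs
∈-alls h []       = here refl
∈-alls h (p ∷ ps) = ∈-cartesianProductWith⁺ _∷_ (h _ p) (∈-alls h ps)

∈-select : ∀ {A : Set} {P : A → Set} (P? : Decidable P) {x xs} .(p : P x) → x ∈ xs → (x , [ p ]) ∈ select P? xs
∈-select P? {xs = y ∷ xs} p (here refl) with P? y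
... | yes _  = here refl
... | no  ¬p = contradiction-irr p ¬p
∈-select P? {xs = y ∷ xs} p (there x∈xs) with P? y
... | yes _ = there (∈-select P? p x∈xs)
... | no  _ = ∈-select P? p x∈xs

select-∈ : ∀ {A : Set} {P : A → Set} (P? : Decidable P) {r} xs → r ∈ select P? xs → value r ∈ xs
select-∈ P? (y ∷ xs) r∈ with P? y
select-∈ P? (y ∷ xs) (here refl) | yes _ = here refl
select-∈ P? (y ∷ xs) (there r∈)  | yes _ = there (select-∈ P? xs r∈)
select-∈ P? (y ∷ xs) r∈          | no  _ = there (select-∈ P? xs r∈)

unique-listsUpTo : ∀ {A : Set} {xs : List A} k → Unique xs → Unique (listsUpTo k xs)
unique-listsUpTo zero u = [] ∷ []
unique-listsUpTo {xs = xs} (suc k) u =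
  All.tabulate (λ l∈ eq → []∉ (subst (_∈ _) (sym eq) l∈)) ∷
  Unique.cartesianProductWith⁺ _∷_ ∷-injective u (unique-listsUpTo k u)
  where
  []∉ : [] ∈ cartesianProductWith _∷_ xs (listsUpTo k xs) → ⊥
  []∉ p with ∈-cartesianProductWith⁻ _∷_ xs _ p
  ... | _ , _ , _ , _ , ()

unique-vecs : ∀ {A : Set} {xs : List A} k → Unique xs → Unique (vecs k xs)
unique-vecs zero    u = [] ∷ []
unique-vecs (suc k) u = Unique.cartesianProductWith⁺ _∷_ Vec.∷-injective u (unique-vecs k u)

unique-alls : ∀ {A : Set} {P : A → Set} {f : ∀ x → List (P x)} → (∀ x → Unique (f x)) → ∀ xs → Unique (alls f xs)
unique-alls u []       = [] ∷ []
unique-alls u (x ∷ xs) = Unique.cartesianProductWith⁺ _∷_ (λ { refl → refl , refl }) (u x) (unique-alls u xs)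

unique-select : ∀ {A : Set} {P : A → Set} (P? : Decidable P) {xs} → Unique xs → Unique (select P? xs)
unique-select P? [] = []
unique-select P? {x ∷ xs} (x∉ ∷ u) with P? x
... | yes p = All.tabulate (λ r∈ eq → All.lookup x∉ (select-∈ P? xs r∈) (cong value eq)) ∷ unique-select P? u
... | no  _ = unique-select P? u

∈-positiveLists : ∀ {n l} → All NonZero l → sum l ≤ n → l ∈ positiveLists n
∈-positiveLists nz s≤n = ∈-listsUpTo (entries nz s≤n) (≤-trans (length≤sum nz) s≤n)
  where
  entries : ∀ {n l} → All NonZero l → sum l ≤ n → All (_∈ map suc (upTo n)) l
  entries [] _ = []
  entries {l = suc a ∷ l} (_ ∷ nz) s≤n =
    ∈-map⁺ suc (∈-upTo⁺ (≤-trans (m≤m+n (suc a) (sum l)) s≤n)) ∷ entries nz (≤-trans (m≤n+m (sum l) (suc a)) s≤n)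
  length≤sum : ∀ {l} → All NonZero l → length l ≤ sum l
  length≤sum []                   = ≤-refl
  length≤sum {suc a ∷ l} (_ ∷ nz) = s≤s (≤-trans (length≤sum nz) (m≤n+m (sum l) a))

unique-positiveLists : ∀ n → Unique (positiveLists n)
unique-positiveLists n = unique-listsUpTo n (Unique.map⁺ suc-injective (Unique.upTo⁺ n))

types-complete : ∀ {n} (τ : Typ n) → τ ∈ types n
types-complete {n} (v , [ w ]) =
  ∈-select (λ τ → weightFrom 1 (toList τ) ≟ n) w (∈-vecs v (bound 1 (toList v) (≤-reflexive (recompute (_ ≟ n) w))))
  where
  bound : ∀ i .{{_ : NonZero i}} ps → weightFrom i ps ≤ n → All (_∈ partitions n) ps
  bound i [] _ = []
  bound i ((l , [ isP ]) ∷ ps) w≤n =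
    ∈-select isPartition? isP (∈-filter⁺ (λ l → size l ≤? n) (∈-positiveLists (proj₁ (recompute (isPartition? l) isP)) l≤n) l≤n)
    ∷ bound (suc i) ps (≤-trans (m≤n+m _ (i * size l)) w≤n)
    where
    l≤n : size l ≤ n
    l≤n = ≤-trans (m≤n*m (size l) i) (≤-trans (m≤m+n (i * size l) _) w≤n)

types-unique : ∀ n → Unique (types n)
types-unique n = unique-select _ (unique-vecs n (unique-select _ (Unique.filter⁺ (λ l → size l ≤? n) (unique-positiveLists n))))

tabloids-complete : ∀ {n} (σ : Typ n) (T : Tabloid σ) → T ∈ tabloids σ
tabloids-complete σ = ∈-alls (λ p → ∈-alls rowTilings-complete)
  where
  rowTilings-complete : ∀ d (ρ : RowTiling d) → ρ ∈ rowTilings d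
  rowTilings-complete d (row as bs , [ c ]) with recompute (covers? d (row as bs)) c
  ... | (as>0 , bs>0) , eq = ∈-select (covers? d) c (∈-cartesianProductWith⁺ row
    (∈-positiveLists as>0 (≤-trans (m≤m+n (sum as) _) (≤-reflexive eq)))
    (∈-positiveLists bs>0 (≤-trans (m≤n*m (sum bs) 2) (≤-trans (m≤n+m _ (sum as)) (≤-reflexive eq)))))

tabloids-unique : ∀ {n} (σ : Typ n) → Unique (tabloids σ)
tabloids-unique σ = unique-alls (λ p → unique-alls rowTilings-unique (parts p)) (factors σ)
  where
  rowTilings-unique : ∀ d → Unique (rowTilings d)
  rowTilings-unique d = unique-select (covers? d)
    (Unique.cartesianProductWith⁺ row (λ { refl → refl , refl }) (unique-positiveLists d) (unique-positiveLists d))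

{-# OPTIONS --safe #-}
module Submission where

-- With E(t) = Σ_d E_d t^d = ∏ (1 - x t^deg x) and E⁺(t) = ∏ (1 + x t^deg x),
-- the product E(t) E⁺(t) = ∏ (1 - x² t^{2 deg x}) is the series Σ_b E_{b²} t^{2b}.
-- Hence E⁺ = (Σ_b E_{b²} t^{2b}) / (1 + Σ_{a ≥ 1} E_a t^a), whose geometric
-- expansion is a signed sum over compositions (the bricks) followed by at most
-- one doublebrick; replacing x by x^r and multiplying over the rows gives the
-- expansion of E⁺_σ.
-- For uniqueness, pair E_ρ with the monomial ∏ x_{d,j}^r with one fresh variable
-- for each block d^r of τ.  A block of ρ selects variables whose degrees sum to
-- its own, so Σ d² over ρ is at least Σ d² over τ, with equality only for
-- ρ = τ: the matrix of these coefficients is triangular.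

open import Algebra.Bundles using (CommutativeMonoid; CommutativeRing)
import Algebra.Properties.CommutativeSemigroup as CommutativeSemigroupProperties
import Algebra.Properties.Group as GroupProperties
import Algebra.Properties.Ring as RingProperties
open import Algebra.Structures using (IsCommutativeRing)
open import Data.Bool.Base using (true; false; if_then_else_; _∧_)
open import Data.Irrelevant using ([_])
open import Data.List.Base using (List; []; _∷_; _++_; map; filter; foldr; concat; concatMap; length; upTo; cartesianProductWith)
open import Data.List.Membership.Propositional using (_∈_)
open import Data.List.Membership.Propositional.Properties using (∈-upTo⁺; ∈-cartesianProductWith⁺; ∈-cartesianProductWith⁻; ∈-map⁺; ∈-map⁻; ∈-++⁻)
open import Data.List.Properties using (map-++; map-∘; map-id; filter-++; filter-all; filter-none; length-++; map-applyUpTo; ++-identityʳ)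
import Data.List.Relation.Binary.Pointwise as Pointwise
open import Data.List.Relation.Binary.Permutation.Propositional as ↭ using (_↭_; ↭-refl; ↭-sym; ↭-trans; ↭-reflexive)
open import Data.List.Relation.Binary.Permutation.Propositional.Properties using (map⁺; ++⁺; ++⁺ˡ; ++⁺ʳ; shift; drop-∷; filter-↭; All-resp-↭; ∈-resp-↭; ↭-empty-inv; ++-commutativeMonoid)
open import Data.List.Relation.Unary.All as All using (All; []; _∷_)
import Data.List.Relation.Unary.All.Properties as All
open import Data.List.Relation.Unary.AllPairs using ([]; _∷_)
open import Data.List.Relation.Unary.Any using (here; there)
open import Data.List.Relation.Unary.Linked using ([])
import Data.List.Relation.Unary.Sorted.TotalOrder.Properties as Sorted
open import Data.List.Relation.Unary.Unique.Propositional using (Unique)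
import Data.List.Relation.Unary.Unique.Propositional.Properties as Unique
open import Data.List.Sort.InsertionSort using (insert)
import Data.List.Sort.InsertionSort.Properties as InsertionSortProperties
open import Data.Nat using (ℕ)
open import Data.Nat.Base using (zero; suc; _+_; _*_; _∸_; _≤_; _<_; z≤n; s≤s; s≤s⁻¹; NonZero)
open import Data.Nat.Divisibility using (_∣_; _∣?_; divides; quotient; _∣0; ∣-refl)
open import Data.Nat.ListAction using (sum)
open import Data.Nat.ListAction.Properties using (sum-++; sum-↭)
open import Data.Nat.Properties
open import Data.Nat.Tactic.RingSolver using (solve-∀)
open import Data.Product.Base using (_×_; _,_; proj₁; proj₂; ∃-syntax; ∃₂)
open import Data.Rational.Base as ℚ using (ℚ; 0ℚ; 1ℚ)
import Data.Rational.Properties as ℚ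
open import Data.Refinement.Base using (value; _,_)
open import Data.Sum.Base using (inj₁; inj₂)
open import Data.Vec.Base using (Vec; []; _∷_; toList; replicate)
open import Defs
open import Function.Base using (_∘_; it)
open import Relation.Binary.Bundles using (DecTotalOrder; Setoid)
import Relation.Binary.Construct.Flip.EqAndOrd as Flip
open import Relation.Binary.PropositionalEquality using (_≡_; _≢_; refl; sym; trans; cong; cong₂; subst; module ≡-Reasoning)
import Relation.Binary.Reasoning.Setoid as SetoidReasoning
open import Relation.Nullary using (¬_; Dec; yes; no; does; contradiction; recompute)
open import Relation.Nullary.Decidable using (_×-dec_)
open import Relation.Unary using (Decidable)

open Block
open Row

-- The variable t of the generating functions is never formalised. An identity in t is stated one
-- degree at a time, as a sum over `splitsℕ d`. Because the degree of a monomial is known only after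
-- all its entries have been read, the factorisation of E(t) E⁺(t) is proved entry by entry against
-- an arbitrary function of the degree. The quotient is not formed either: removing the first brick
-- shows that the signed sum over row tilings satisfies the recursion which E(t) E⁺(t) = Σ E_{b²}
-- t^{2b} imposes on E⁺. Triangularity alone does not give uniqueness; the diagonal coefficients
-- must also be nonzero. If τ has repeated blocks, several assignments of variables to blocks
-- contribute to the coefficient at its monomial. They cannot cancel: each block takes exactly one
-- variable and contributes -1, so every assignment has the same sign, (-1) to the number of blocks.
-- Multiplied by this sign, the coefficient is a sum of nonnegative terms, at least one of them
-- positive.

private variable
  A A′ A″ : Set

-- The operations of ℚ match on their arguments, so the summands of a sum cannot be
-- inferred by unification; the opaque copies below make them inferable.
infixl 6 _⊕_
infixl 7 _⊗_
infix  8 ⊝_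
infixr 7 _⊛ᵒ_
opaque
  _⊕_ _⊗_ : ℚ → ℚ → ℚ
  _⊕_ = ℚ._+_
  _⊗_ = ℚ._*_

  ⊝_ : ℚ → ℚ
  ⊝_ = ℚ.-_

  _⊛ᵒ_ : Series → Series → Series
  _⊛ᵒ_ = _⊛_

  ⊕-⊗-isCommutativeRing : IsCommutativeRing _≡_ _⊕_ _⊗_ ⊝_ 0ℚ 1ℚ
  ⊕-⊗-isCommutativeRing = ℚ.+-*-isCommutativeRing

∑ᵒ : List A → (A → ℚ) → ℚ
∑ᵒ xs f = foldr (λ x q → f x ⊕ q) 0ℚ xs

opaque
  unfolding _⊕_ _⊛ᵒ_

  ∑≡∑ᵒ : ∀ (xs : List A) f → ∑ xs f ≡ ∑ᵒ xs f
  ∑≡∑ᵒ xs f = refl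

  ⊛-∑ : ∀ F G m → (F ⊛ᵒ G) m ≡ ∑ᵒ (splits m) λ (f , g) → F f ⊗ G g
  ⊛-∑ F G m = refl

⊕-⊗-commutativeRing : CommutativeRing _ _
⊕-⊗-commutativeRing = record { isCommutativeRing = ⊕-⊗-isCommutativeRing }

module ℚᵒ = CommutativeRing ⊕-⊗-commutativeRing
open CommutativeSemigroupProperties (CommutativeMonoid.commutativeSemigroup ℚᵒ.+-commutativeMonoid)
  using () renaming (interchange to +-interchange; x∙yz≈y∙xz to +-leftComm)
open CommutativeSemigroupProperties ℚᵒ.*-commutativeSemigroup
  using () renaming (interchange to *-interchange; x∙yz≈y∙xz to *-leftComm)
open CommutativeSemigroupProperties +-commutativeSemigroup
  using () renaming (interchange to +-interchangeℕ)
open CommutativeSemigroupProperties (CommutativeMonoid.commutativeSemigroup (++-commutativeMonoid {A = Block}))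
  using () renaming (interchange to ++-interchange)
open RingProperties ℚᵒ.ring using (-1*x≈-x)
open GroupProperties ℚᵒ.+-group using (∙-cancelˡ; ∙-cancelʳ; ⁻¹-involutive)

-- Finite sums

∑-cong-∈ : ∀ (xs : List A) {f g : A → ℚ} → (∀ {x} → x ∈ xs → f x ≡ g x) → ∑ᵒ xs f ≡ ∑ᵒ xs g
∑-cong-∈ []       f≗g = refl
∑-cong-∈ (x ∷ xs) f≗g = cong₂ _⊕_ (f≗g (here refl)) (∑-cong-∈ xs (f≗g ∘ there))

∑-cong : ∀ (xs : List A) {f g : A → ℚ} → (∀ x → f x ≡ g x) → ∑ᵒ xs f ≡ ∑ᵒ xs g
∑-cong xs f≗g = ∑-cong-∈ xs λ {x} _ → f≗g x

∑-zero : ∀ (xs : List A) {f : A → ℚ} → (∀ {x} → x ∈ xs → f x ≡ 0ℚ) → ∑ᵒ xs f ≡ 0ℚ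
∑-zero []       f≗0 = refl
∑-zero (x ∷ xs) f≗0 = trans (cong₂ _⊕_ (f≗0 (here refl)) (∑-zero xs (f≗0 ∘ there))) (ℚᵒ.+-identityˡ 0ℚ)

∑-++ : ∀ (xs ys : List A) {f : A → ℚ} → ∑ᵒ (xs ++ ys) f ≡ ∑ᵒ xs f ⊕ ∑ᵒ ys f
∑-++ []       ys     = sym (ℚᵒ.+-identityˡ _)
∑-++ (x ∷ xs) ys {f} = trans (cong (f x ⊕_) (∑-++ xs ys)) (sym (ℚᵒ.+-assoc (f x) _ _))

∑-map : ∀ (g : A → A′) (xs : List A) {f : A′ → ℚ} → ∑ᵒ (map g xs) f ≡ ∑ᵒ xs (f ∘ g)
∑-map g []           = refl
∑-map g (x ∷ xs) {f} = cong (f (g x) ⊕_) (∑-map g xs)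

∑-+ : ∀ (xs : List A) {f g : A → ℚ} → ∑ᵒ xs (λ x → f x ⊕ g x) ≡ ∑ᵒ xs f ⊕ ∑ᵒ xs g
∑-+ []               = sym (ℚᵒ.+-identityˡ 0ℚ)
∑-+ (x ∷ xs) {f} {g} = trans (cong (f x ⊕ g x ⊕_) (∑-+ xs)) (+-interchange (f x) (g x) _ _)

*-∑ : ∀ q (xs : List A) {f : A → ℚ} → q ⊗ ∑ᵒ xs f ≡ ∑ᵒ xs (λ x → q ⊗ f x)
*-∑ q []           = ℚᵒ.zeroʳ q
*-∑ q (x ∷ xs) {f} = trans (ℚᵒ.distribˡ q (f x) _) (cong (q ⊗ f x ⊕_) (*-∑ q xs))

∑-* : ∀ (xs : List A) {f : A → ℚ} q → ∑ᵒ xs f ⊗ q ≡ ∑ᵒ xs (λ x → f x ⊗ q)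
∑-* []           q = ℚᵒ.zeroˡ q
∑-* (x ∷ xs) {f} q = trans (ℚᵒ.distribʳ q (f x) _) (cong (f x ⊗ q ⊕_) (∑-* xs q))

∑-swap : ∀ (xs : List A) (ys : List A′) {f : A → A′ → ℚ} →
         ∑ᵒ xs (λ x → ∑ᵒ ys (f x)) ≡ ∑ᵒ ys (λ y → ∑ᵒ xs (λ x → f x y))
∑-swap []       ys     = sym (∑-zero ys λ _ → refl)
∑-swap (x ∷ xs) ys {f} = trans (cong (∑ᵒ ys (f x) ⊕_) (∑-swap xs ys)) (sym (∑-+ ys))

∑-cartesianProductWith : ∀ (p : A → A′ → A″) xs ys {f : A″ → ℚ} →
  ∑ᵒ (cartesianProductWith p xs ys) f ≡ ∑ᵒ xs (λ x → ∑ᵒ ys (λ y → f (p x y)))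
∑-cartesianProductWith p []       ys = refl
∑-cartesianProductWith p (x ∷ xs) ys =
  trans (∑-++ (map (p x) ys) _) (cong₂ _⊕_ (∑-map (p x) ys) (∑-cartesianProductWith p xs ys))

ind : ∀ {P : Set} → Dec P → ℚ
ind P? = if does P? then 1ℚ else 0ℚ

ind-true : ∀ {P : Set} (P? : Dec P) → P → ind P? ≡ 1ℚ
ind-true (yes _) p = refl
ind-true (no ¬p) p = contradiction p ¬p

ind-false : ∀ {P : Set} (P? : Dec P) → ¬ P → ind P? ≡ 0ℚ
ind-false (yes p) ¬p = contradiction p ¬p
ind-false (no _)  ¬p = refl

ind-cong : ∀ {P Q : Set} (P? : Dec P) (Q? : Dec Q) → (P → Q) → (Q → P) → ind P? ≡ ind Q?
ind-cong (yes p) Q?      to from = sym (ind-true Q? (to p))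
ind-cong (no ¬p) (yes q) to from = contradiction (from q) ¬p
ind-cong (no _)  (no _)  to from = refl

ind-∧ : ∀ {P Q R : Set} (R? : Dec R) (P? : Dec P) (Q? : Dec Q) → does R? ≡ does P? ∧ does Q? → ind R? ≡ ind P? ⊗ ind Q?
ind-∧ R? P? Q? eq = trans (cong (if_then 1ℚ else 0ℚ) eq) (lemma (does P?) (does Q?))
  where
  lemma : ∀ b c → (if b ∧ c then 1ℚ else 0ℚ) ≡ (if b then 1ℚ else 0ℚ) ⊗ (if c then 1ℚ else 0ℚ)
  lemma true  c = sym (ℚᵒ.*-identityˡ _)
  lemma false c = sym (ℚᵒ.zeroˡ _)

∑-select : ∀ {P : A → Set} (P? : Decidable P) (xs : List A) {f : A → ℚ} →
           ∑ᵒ (select P? xs) (f ∘ value) ≡ ∑ᵒ xs (λ x → ind (P? x) ⊗ f x)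
∑-select P? []           = refl
∑-select P? (x ∷ xs) {f} with P? x
... | yes _ = cong₂ _⊕_ (sym (ℚᵒ.*-identityˡ (f x))) (∑-select P? xs)
... | no  _ = trans (∑-select P? xs) (sym (trans (cong (_⊕ _) (ℚᵒ.zeroˡ (f x))) (ℚᵒ.+-identityˡ _)))

∑-filter : ∀ {P : A → Set} (P? : Decidable P) (xs : List A) {f : A → ℚ} →
           ∑ᵒ (filter P? xs) f ≡ ∑ᵒ xs (λ x → ind (P? x) ⊗ f x)
∑-filter P? []           = refl
∑-filter P? (x ∷ xs) {f} with P? x
... | yes _ = cong₂ _⊕_ (sym (ℚᵒ.*-identityˡ (f x))) (∑-filter P? xs)
... | no  _ = trans (∑-filter P? xs) (sym (trans (cong (_⊕ _) (ℚᵒ.zeroˡ (f x))) (ℚᵒ.+-identityˡ _)))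

-- Tested on sums against arbitrary functions rather than as equalities of lists of splittings: the
-- two sides enumerate in different orders, and sums are all that a product of series uses.
Coassociative Cocommutative : (A → List (A × A)) → Set
Coassociative {A} s = ∀ x (h : A → A → A → ℚ) →
  ∑ᵒ (s x) (λ (a , b) → ∑ᵒ (s a) (λ (c , d) → h c d b)) ≡ ∑ᵒ (s x) (λ (a , b) → ∑ᵒ (s b) (λ (c , d) → h a c d))
Cocommutative {A} s = ∀ x (h : A → A → ℚ) → ∑ᵒ (s x) (λ (a , b) → h a b) ≡ ∑ᵒ (s x) (λ (a , b) → h b a)

Counital : (A → List (A × A)) → (A → ℚ) → Set
Counital {A} s ε = ∀ x (h : A → ℚ) → ∑ᵒ (s x) (λ (a , b) → ε a ⊗ h b) ≡ h x

∑-splitsℕ-suc : ∀ e {h : ℕ → ℕ → ℚ} →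
  ∑ᵒ (splitsℕ (suc e)) (λ (a , b) → h a b) ≡ h 0 (suc e) ⊕ ∑ᵒ (splitsℕ e) (λ (a , b) → h (suc a) b)
∑-splitsℕ-suc e {h} = cong (h 0 (suc e) ⊕_) (∑-map _ (splitsℕ e))

-- `splitsℕ` recurses on the left half only; this mirror image of its defining equation is what
-- makes cocommutativity an induction.
∑-splitsℕ-sucʳ : ∀ e {h : ℕ → ℕ → ℚ} →
  ∑ᵒ (splitsℕ (suc e)) (λ (a , b) → h a b) ≡ h (suc e) 0 ⊕ ∑ᵒ (splitsℕ e) (λ (a , b) → h a (suc b))
∑-splitsℕ-sucʳ zero    {h} = begin
  h 0 1 ⊕ (h 1 0 ⊕ 0ℚ) ≡⟨ ℚᵒ.+-assoc (h 0 1) _ _ ⟨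
  h 0 1 ⊕ h 1 0 ⊕ 0ℚ   ≡⟨ cong (_⊕ 0ℚ) (ℚᵒ.+-comm (h 0 1) _) ⟩
  h 1 0 ⊕ h 0 1 ⊕ 0ℚ   ≡⟨ ℚᵒ.+-assoc (h 1 0) _ _ ⟩
  h 1 0 ⊕ (h 0 1 ⊕ 0ℚ) ∎
  where open ≡-Reasoning
∑-splitsℕ-sucʳ (suc e) {h} = begin
  ∑ᵒ (splitsℕ (2+ e)) (λ (a , b) → h a b)
    ≡⟨ ∑-splitsℕ-suc (suc e) ⟩
  h 0 (2+ e) ⊕ ∑ᵒ (splitsℕ (suc e)) (λ (a , b) → h (suc a) b)
    ≡⟨ cong (h 0 (2+ e) ⊕_) (∑-splitsℕ-sucʳ e) ⟩
  h 0 (2+ e) ⊕ (h (2+ e) 0 ⊕ S)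
    ≡⟨ +-leftComm (h 0 (2+ e)) _ _ ⟩
  h (2+ e) 0 ⊕ (h 0 (2+ e) ⊕ S)
    ≡⟨ cong (h (2+ e) 0 ⊕_) (∑-splitsℕ-suc e) ⟨
  h (2+ e) 0 ⊕ ∑ᵒ (splitsℕ (suc e)) (λ (a , b) → h a (suc b)) ∎
  where
  open ≡-Reasoning
  2+ : ℕ → ℕ
  2+ e = suc (suc e)
  S = ∑ᵒ (splitsℕ e) (λ (a , b) → h (suc a) (suc b))

splitsℕ-coassociative : Coassociative splitsℕ
splitsℕ-coassociative zero    h = refl
splitsℕ-coassociative (suc e) h = begin
  ∑ᵒ (splitsℕ (suc e)) (λ (a , b) → ∑ᵒ (splitsℕ a) (λ (c , d) → h c d b))
    ≡⟨ ∑-splitsℕ-suc e ⟩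
  (h 0 0 (suc e) ⊕ 0ℚ) ⊕ ∑ᵒ (splitsℕ e) (λ (a , b) → ∑ᵒ (splitsℕ (suc a)) (λ (c , d) → h c d b))
    ≡⟨ cong₂ _⊕_ (ℚᵒ.+-identityʳ _) (trans (∑-cong (splitsℕ e) λ (a , b) → ∑-splitsℕ-suc a) (∑-+ (splitsℕ e))) ⟩
  h 0 0 (suc e) ⊕ (∑ᵒ (splitsℕ e) (λ (a , b) → h 0 (suc a) b)
    ⊕ ∑ᵒ (splitsℕ e) (λ (a , b) → ∑ᵒ (splitsℕ a) (λ (c , d) → h (suc c) d b)))
    ≡⟨ ℚᵒ.+-assoc (h 0 0 (suc e)) _ _ ⟨
  h 0 0 (suc e) ⊕ ∑ᵒ (splitsℕ e) (λ (a , b) → h 0 (suc a) b)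
    ⊕ ∑ᵒ (splitsℕ e) (λ (a , b) → ∑ᵒ (splitsℕ a) (λ (c , d) → h (suc c) d b))
    ≡⟨ cong₂ _⊕_ (sym (∑-splitsℕ-suc e)) (splitsℕ-coassociative e λ c d b → h (suc c) d b) ⟩
  ∑ᵒ (splitsℕ (suc e)) (λ (c , d) → h 0 c d)
    ⊕ ∑ᵒ (splitsℕ e) (λ (a , b) → ∑ᵒ (splitsℕ b) (λ (c , d) → h (suc a) c d))
    ≡⟨ ∑-splitsℕ-suc e ⟨
  ∑ᵒ (splitsℕ (suc e)) (λ (a , b) → ∑ᵒ (splitsℕ b) (λ (c , d) → h a c d)) ∎
  where open ≡-Reasoning

splitsℕ-cocommutative : Cocommutative splitsℕ
splitsℕ-cocommutative zero    h = refl
splitsℕ-cocommutative (suc e) h = begin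
  ∑ᵒ (splitsℕ (suc e)) (λ (a , b) → h a b)                      ≡⟨ ∑-splitsℕ-suc e ⟩
  h 0 (suc e) ⊕ ∑ᵒ (splitsℕ e) (λ (a , b) → h (suc a) b)     ≡⟨ cong (h 0 (suc e) ⊕_) (splitsℕ-cocommutative e λ a b → h (suc a) b) ⟩
  h 0 (suc e) ⊕ ∑ᵒ (splitsℕ e) (λ (a , b) → h (suc b) a)     ≡⟨ ∑-splitsℕ-sucʳ e ⟨
  ∑ᵒ (splitsℕ (suc e)) (λ (a , b) → h b a)                      ∎
  where open ≡-Reasoning

splitsℕ-counital : Counital splitsℕ (λ e → ind (e ≟ 0))
splitsℕ-counital zero    h = trans (ℚᵒ.+-identityʳ _) (ℚᵒ.*-identityˡ (h 0))
splitsℕ-counital (suc e) h = begin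
  ∑ᵒ (splitsℕ (suc e)) (λ (a , b) → ind (a ≟ 0) ⊗ h b)
    ≡⟨ ∑-splitsℕ-suc e ⟩
  1ℚ ⊗ h (suc e) ⊕ ∑ᵒ (splitsℕ e) (λ (a , b) → 0ℚ ⊗ h b)
    ≡⟨ cong₂ _⊕_ (ℚᵒ.*-identityˡ _) (∑-zero (splitsℕ e) λ {(a , b)} _ → ℚᵒ.zeroˡ (h b)) ⟩
  h (suc e) ⊕ 0ℚ
    ≡⟨ ℚᵒ.+-identityʳ _ ⟩
  h (suc e) ∎
  where open ≡-Reasoning

module _ (s : A → List (A × A)) where

  ∑-splitsList-∷ : ∀ x xs {h : List A → List A → ℚ} →
    ∑ᵒ (splitsList s (x ∷ xs)) (λ (as , bs) → h as bs) ≡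
    ∑ᵒ (s x) (λ (a , b) → ∑ᵒ (splitsList s xs) (λ (as , bs) → h (a ∷ as) (b ∷ bs)))
  ∑-splitsList-∷ x xs = ∑-cartesianProductWith _ (s x) (splitsList s xs)

  splitsList-cocommutative : Cocommutative s → Cocommutative (splitsList s)
  splitsList-cocommutative comm []       h = refl
  splitsList-cocommutative comm (x ∷ xs) h = begin
    ∑ᵒ (splitsList s (x ∷ xs)) (λ (as , bs) → h as bs)
      ≡⟨ ∑-splitsList-∷ x xs ⟩
    ∑ᵒ (s x) (λ (a , b) → ∑ᵒ (splitsList s xs) (λ (as , bs) → h (a ∷ as) (b ∷ bs)))
      ≡⟨ comm x (λ a b → ∑ᵒ (splitsList s xs) (λ (as , bs) → h (a ∷ as) (b ∷ bs))) ⟩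
    ∑ᵒ (s x) (λ (a , b) → ∑ᵒ (splitsList s xs) (λ (as , bs) → h (b ∷ as) (a ∷ bs)))
      ≡⟨ ∑-cong (s x) (λ (a , b) → splitsList-cocommutative comm xs λ as bs → h (b ∷ as) (a ∷ bs)) ⟩
    ∑ᵒ (s x) (λ (a , b) → ∑ᵒ (splitsList s xs) (λ (as , bs) → h (b ∷ bs) (a ∷ as)))
      ≡⟨ ∑-splitsList-∷ x xs ⟨
    ∑ᵒ (splitsList s (x ∷ xs)) (λ (as , bs) → h bs as) ∎
    where open ≡-Reasoning

  splitsList-coassociative : Coassociative s → Coassociative (splitsList s)
  splitsList-coassociative assoc []       h = refl
  splitsList-coassociative assoc (x ∷ xs) h = begin
    ∑ᵒ (S (x ∷ xs)) (λ (as , bs) → ∑ᵒ (S as) (λ (cs , ds) → h cs ds bs))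
      ≡⟨ ∑-splitsList-∷ x xs ⟩
    ∑ᵒ (s x) (λ (a , b) → ∑ᵒ (S xs) (λ (as , bs) → ∑ᵒ (S (a ∷ as)) (λ (cs , ds) → h cs ds (b ∷ bs))))
      ≡⟨ ∑-cong (s x) (λ (a , b) → ∑-cong (S xs) λ (as , bs) → ∑-splitsList-∷ a as) ⟩
    ∑ᵒ (s x) (λ (a , b) → ∑ᵒ (S xs) (λ (as , bs) → ∑ᵒ (s a) (λ (c , d) → ∑ᵒ (S as) (λ (cs , ds) → h (c ∷ cs) (d ∷ ds) (b ∷ bs)))))
      ≡⟨ ∑-cong (s x) (λ (a , b) → ∑-swap (S xs) (s a)) ⟩
    ∑ᵒ (s x) (λ (a , b) → ∑ᵒ (s a) (λ (c , d) → ∑ᵒ (S xs) (λ (as , bs) → ∑ᵒ (S as) (λ (cs , ds) → h (c ∷ cs) (d ∷ ds) (b ∷ bs)))))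
      ≡⟨ assoc x (λ c d b → ∑ᵒ (S xs) (λ (as , bs) → ∑ᵒ (S as) (λ (cs , ds) → h (c ∷ cs) (d ∷ ds) (b ∷ bs)))) ⟩
    ∑ᵒ (s x) (λ (a , b) → ∑ᵒ (s b) (λ (c , d) → ∑ᵒ (S xs) (λ (as , bs) → ∑ᵒ (S as) (λ (cs , ds) → h (a ∷ cs) (c ∷ ds) (d ∷ bs)))))
      ≡⟨ ∑-cong (s x) (λ (a , b) → ∑-cong (s b) λ (c , d) → splitsList-coassociative assoc xs λ cs ds bs → h (a ∷ cs) (c ∷ ds) (d ∷ bs)) ⟩
    ∑ᵒ (s x) (λ (a , b) → ∑ᵒ (s b) (λ (c , d) → ∑ᵒ (S xs) (λ (as , bs) → ∑ᵒ (S bs) (λ (cs , ds) → h (a ∷ as) (c ∷ cs) (d ∷ ds)))))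
      ≡⟨ ∑-cong (s x) (λ (a , b) → ∑-swap (s b) (S xs)) ⟩
    ∑ᵒ (s x) (λ (a , b) → ∑ᵒ (S xs) (λ (as , bs) → ∑ᵒ (s b) (λ (c , d) → ∑ᵒ (S bs) (λ (cs , ds) → h (a ∷ as) (c ∷ cs) (d ∷ ds)))))
      ≡⟨ ∑-cong (s x) (λ (a , b) → ∑-cong (S xs) λ (as , bs) → ∑-splitsList-∷ b bs) ⟨
    ∑ᵒ (s x) (λ (a , b) → ∑ᵒ (S xs) (λ (as , bs) → ∑ᵒ (S (b ∷ bs)) (λ (cs , ds) → h (a ∷ as) cs ds)))
      ≡⟨ ∑-splitsList-∷ x xs ⟨
    ∑ᵒ (S (x ∷ xs)) (λ (as , bs) → ∑ᵒ (S bs) (λ (cs , ds) → h as cs ds)) ∎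
    where
    open ≡-Reasoning
    S = splitsList s

  splitsList-counital : ∀ {P : A → Set} (P? : Decidable P) →
    Counital s (ind ∘ P?) → Counital (splitsList s) (ind ∘ All.all? P?)
  splitsList-counital P? counit []       h = trans (ℚᵒ.+-identityʳ _) (ℚᵒ.*-identityˡ (h []))
  splitsList-counital P? counit (x ∷ xs) h = begin
    ∑ᵒ (S (x ∷ xs)) (λ (as , bs) → ind (All.all? P? as) ⊗ h bs)
      ≡⟨ ∑-splitsList-∷ x xs ⟩
    ∑ᵒ (s x) (λ (a , b) → ∑ᵒ (S xs) (λ (as , bs) → ind (All.all? P? (a ∷ as)) ⊗ h (b ∷ bs)))
      ≡⟨ ∑-cong (s x) (λ (a , b) → ∑-cong (S xs) λ (as , bs) → trans (cong (_⊗ h (b ∷ bs)) (ind-all a as)) (ℚᵒ.*-assoc (ind (P? a)) _ _)) ⟩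
    ∑ᵒ (s x) (λ (a , b) → ∑ᵒ (S xs) (λ (as , bs) → ind (P? a) ⊗ (ind (All.all? P? as) ⊗ h (b ∷ bs))))
      ≡⟨ ∑-cong (s x) (λ (a , b) → sym (*-∑ (ind (P? a)) (S xs))) ⟩
    ∑ᵒ (s x) (λ (a , b) → ind (P? a) ⊗ ∑ᵒ (S xs) (λ (as , bs) → ind (All.all? P? as) ⊗ h (b ∷ bs)))
      ≡⟨ ∑-cong (s x) (λ (a , b) → cong (ind (P? a) ⊗_) (splitsList-counital P? counit xs (h ∘ (b ∷_)))) ⟩
    ∑ᵒ (s x) (λ (a , b) → ind (P? a) ⊗ h (b ∷ xs))
      ≡⟨ counit x (λ b → h (b ∷ xs)) ⟩
    h (x ∷ xs) ∎
    where
    open ≡-Reasoning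
    S = splitsList s
    ind-all : ∀ a as → ind (All.all? P? (a ∷ as)) ≡ ind (P? a) ⊗ ind (All.all? P? as)
    ind-all a as = ind-∧ (All.all? P? (a ∷ as)) (P? a) (All.all? P? as) refl

-- The algebra of series

≈-setoid : Setoid _ _
≈-setoid = record
  { Carrier       = Series
  ; _≈_           = _≈_
  ; isEquivalence = record { refl = λ _ → refl ; sym = λ F≈G m → sym (F≈G m) ; trans = λ F≈G G≈H m → trans (F≈G m) (G≈H m) }
  }

open Setoid ≈-setoid public using () renaming (refl to ≈-refl; sym to ≈-sym; trans to ≈-trans)
module ≈-Reasoning = SetoidReasoning ≈-setoid

infixr 8 _•_
_•_ : ℚ → Series → Series
(q • F) m = q ⊗ F m

∑ˢ : List A → (A → Series) → Series
∑ˢ xs F m = ∑ᵒ xs λ x → F x m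

∑ˢ-cong : ∀ (xs : List A) {F G : A → Series} → (∀ x → F x ≈ G x) → ∑ˢ xs F ≈ ∑ˢ xs G
∑ˢ-cong xs F≈G m = ∑-cong xs λ x → F≈G x m

⊛-cong : ∀ {F F′ G G′} → F ≈ F′ → G ≈ G′ → F ⊛ᵒ G ≈ F′ ⊛ᵒ G′
⊛-cong {F} {F′} {G} {G′} F≈F′ G≈G′ m = trans (⊛-∑ F G m)
  (trans (∑-cong (splits m) λ (f , g) → cong₂ _⊗_ (F≈F′ f) (G≈G′ g)) (sym (⊛-∑ F′ G′ m)))

⊛-comm : ∀ F G → F ⊛ᵒ G ≈ G ⊛ᵒ F
⊛-comm F G m = begin
  (F ⊛ᵒ G) m
    ≡⟨ ⊛-∑ F G m ⟩
  ∑ᵒ (splits m) (λ (f , g) → F f ⊗ G g)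
    ≡⟨ splitsList-cocommutative _ (splitsList-cocommutative _ splitsℕ-cocommutative) m (λ f g → F f ⊗ G g) ⟩
  ∑ᵒ (splits m) (λ (f , g) → F g ⊗ G f)
    ≡⟨ ∑-cong (splits m) (λ (f , g) → ℚᵒ.*-comm (F g) (G f)) ⟩
  ∑ᵒ (splits m) (λ (f , g) → G f ⊗ F g)
    ≡⟨ ⊛-∑ G F m ⟨
  (G ⊛ᵒ F) m ∎
  where open ≡-Reasoning

⊛-assoc : ∀ F G H → (F ⊛ᵒ G) ⊛ᵒ H ≈ F ⊛ᵒ (G ⊛ᵒ H)
⊛-assoc F G H m = begin
  ((F ⊛ᵒ G) ⊛ᵒ H) m
    ≡⟨ ⊛-∑ _ H m ⟩
  ∑ᵒ (splits m) (λ (a , b) → (F ⊛ᵒ G) a ⊗ H b)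
    ≡⟨ ∑-cong (splits m) (λ (a , b) → trans (cong (_⊗ H b) (⊛-∑ F G a)) (∑-* (splits a) (H b))) ⟩
  ∑ᵒ (splits m) (λ (a , b) → ∑ᵒ (splits a) (λ (c , d) → F c ⊗ G d ⊗ H b))
    ≡⟨ splitsList-coassociative _ (splitsList-coassociative _ splitsℕ-coassociative) m (λ c d b → F c ⊗ G d ⊗ H b) ⟩
  ∑ᵒ (splits m) (λ (a , b) → ∑ᵒ (splits b) (λ (c , d) → F a ⊗ G c ⊗ H d))
    ≡⟨ ∑-cong (splits m) (λ (a , b) → ∑-cong (splits b) λ (c , d) → ℚᵒ.*-assoc (F a) (G c) (H d)) ⟩
  ∑ᵒ (splits m) (λ (a , b) → ∑ᵒ (splits b) (λ (c , d) → F a ⊗ (G c ⊗ H d)))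
    ≡⟨ ∑-cong (splits m) (λ (a , b) → trans (cong (F a ⊗_) (⊛-∑ G H b)) (*-∑ (F a) (splits b))) ⟨
  ∑ᵒ (splits m) (λ (a , b) → F a ⊗ (G ⊛ᵒ H) b)
    ≡⟨ ⊛-∑ F _ m ⟨
  (F ⊛ᵒ (G ⊛ᵒ H)) m ∎
  where open ≡-Reasoning

⊛-identityˡ : ∀ F → one ⊛ᵒ F ≈ F
⊛-identityˡ F m = trans (⊛-∑ one F m)
  (splitsList-counital _ _ (splitsList-counital _ _ splitsℕ-counital) m F)

⊛-leftComm : ∀ F G H → F ⊛ᵒ (G ⊛ᵒ H) ≈ G ⊛ᵒ (F ⊛ᵒ H)
⊛-leftComm F G H = begin
  F ⊛ᵒ (G ⊛ᵒ H) ≈⟨ ⊛-assoc F G H ⟨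
  (F ⊛ᵒ G) ⊛ᵒ H ≈⟨ ⊛-cong (⊛-comm F G) ≈-refl ⟩
  (G ⊛ᵒ F) ⊛ᵒ H ≈⟨ ⊛-assoc G F H ⟩
  G ⊛ᵒ (F ⊛ᵒ H) ∎
  where open ≈-Reasoning

∑ˢ-⊛ : ∀ (xs : List A) F G → ∑ˢ xs F ⊛ᵒ G ≈ ∑ˢ xs (λ x → F x ⊛ᵒ G)
∑ˢ-⊛ xs F G m = begin
  (∑ˢ xs F ⊛ᵒ G) m
    ≡⟨ ⊛-∑ _ G m ⟩
  ∑ᵒ (splits m) (λ (f , g) → ∑ᵒ xs (λ x → F x f) ⊗ G g)
    ≡⟨ ∑-cong (splits m) (λ (f , g) → ∑-* xs (G g)) ⟩
  ∑ᵒ (splits m) (λ (f , g) → ∑ᵒ xs (λ x → F x f ⊗ G g))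
    ≡⟨ ∑-swap (splits m) xs ⟩
  ∑ᵒ xs (λ x → ∑ᵒ (splits m) (λ (f , g) → F x f ⊗ G g))
    ≡⟨ ∑-cong xs (λ x → ⊛-∑ (F x) G m) ⟨
  ∑ᵒ xs (λ x → (F x ⊛ᵒ G) m) ∎
  where open ≡-Reasoning

⊛-∑ˢ : ∀ (xs : List A) F G → F ⊛ᵒ ∑ˢ xs G ≈ ∑ˢ xs (λ x → F ⊛ᵒ G x)
⊛-∑ˢ xs F G = begin
  F ⊛ᵒ ∑ˢ xs G              ≈⟨ ⊛-comm F _ ⟩
  ∑ˢ xs G ⊛ᵒ F              ≈⟨ ∑ˢ-⊛ xs G F ⟩
  ∑ˢ xs (λ x → G x ⊛ᵒ F)    ≈⟨ ∑ˢ-cong xs (λ x → ⊛-comm (G x) F) ⟩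
  ∑ˢ xs (λ x → F ⊛ᵒ G x)    ∎
  where open ≈-Reasoning

•-cong : ∀ {p q F G} → p ≡ q → F ≈ G → p • F ≈ q • G
•-cong p≡q F≈G m = cong₂ _⊗_ p≡q (F≈G m)

•-⊛-• : ∀ p q F G → (p • F) ⊛ᵒ (q • G) ≈ (p ⊗ q) • (F ⊛ᵒ G)
•-⊛-• p q F G m = begin
  ((p • F) ⊛ᵒ (q • G)) m
    ≡⟨ ⊛-∑ _ _ m ⟩
  ∑ᵒ (splits m) (λ (f , g) → (p ⊗ F f) ⊗ (q ⊗ G g))
    ≡⟨ ∑-cong (splits m) (λ (f , g) → *-interchange p (F f) q (G g)) ⟩
  ∑ᵒ (splits m) (λ (f , g) → (p ⊗ q) ⊗ (F f ⊗ G g))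
    ≡⟨ *-∑ (p ⊗ q) (splits m) ⟨
  (p ⊗ q) ⊗ ∑ᵒ (splits m) (λ (f , g) → F f ⊗ G g)
    ≡⟨ cong (p ⊗ q ⊗_) (⊛-∑ F G m) ⟨
  (p ⊗ q) ⊗ (F ⊛ᵒ G) m ∎
  where open ≡-Reasoning

⊛-• : ∀ q F G → F ⊛ᵒ (q • G) ≈ q • (F ⊛ᵒ G)
⊛-• q F G = begin
  F ⊛ᵒ (q • G)         ≈⟨ ⊛-cong (λ m → sym (ℚᵒ.*-identityˡ (F m))) ≈-refl ⟩
  (1ℚ • F) ⊛ᵒ (q • G)  ≈⟨ •-⊛-• 1ℚ q F G ⟩
  (1ℚ ⊗ q) • (F ⊛ᵒ G)  ≈⟨ •-cong (ℚᵒ.*-identityˡ q) ≈-refl ⟩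
  q • (F ⊛ᵒ G)         ∎
  where open ≈-Reasoning

blockProduct : (ℕ → Series) → List Block → Series
blockProduct F = foldr (λ b G → blockSeries F b ⊛ᵒ G) one

blockProduct-++ : ∀ F bs cs → blockProduct F (bs ++ cs) ≈ blockProduct F bs ⊛ᵒ blockProduct F cs
blockProduct-++ F []       cs = ≈-sym (⊛-identityˡ _)
blockProduct-++ F (b ∷ bs) cs =
  ≈-trans (⊛-cong ≈-refl (blockProduct-++ F bs cs)) (≈-sym (⊛-assoc (blockSeries F b) _ _))

blockProduct-↭ : ∀ F {bs cs} → bs ↭ cs → blockProduct F bs ≈ blockProduct F cs
blockProduct-↭ F ↭.refl         = ≈-refl
blockProduct-↭ F (↭.prep b p)   = ⊛-cong ≈-refl (blockProduct-↭ F p)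
blockProduct-↭ F (↭.swap b c p) =
  ≈-trans (⊛-leftComm (blockSeries F b) (blockSeries F c) _) (⊛-cong ≈-refl (⊛-cong ≈-refl (blockProduct-↭ F p)))
blockProduct-↭ F (↭.trans p q)  = ≈-trans (blockProduct-↭ F p) (blockProduct-↭ F q)

-- Coefficients of the block series

-- The monomial ∏ x_{i,j}^{e_{i,j}} is recorded as the multiset of the blocks i ↑ e_{i,j} with
-- e_{i,j} ≠ 0; the coefficients of the series E_τ depend on nothing else.
entryBlocks : ℕ → ℕ → List Block
entryBlocks i zero    = []
entryBlocks i (suc e) = i ↑ suc e ∷ []

rowBlocks : ℕ → List ℕ → List Block
rowBlocks i = concatMap (entryBlocks i)

monomialBlocksFrom : ℕ → Monomial → List Block
monomialBlocksFrom i []       = []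
monomialBlocksFrom i (r ∷ rs) = rowBlocks i r ++ monomialBlocksFrom (suc i) rs

monomialBlocks : Monomial → List Block
monomialBlocks = monomialBlocksFrom 1

totalDegree : List Block → ℕ
totalDegree L = sum (map degree L)

totalDegree-++ : ∀ L M → totalDegree (L ++ M) ≡ totalDegree L + totalDegree M
totalDegree-++ L M = trans (cong sum (map-++ degree L M)) (sum-++ (map degree L) (map degree M))

-- The coefficient in ∏ (1 + ε x^r) of the monomial with the given blocks.
χ : ℚ → ℕ → List Block → ℚ
χ ε r = foldr (λ b q → (ind (multiplicity b ≟ r) ⊗ ε) ⊗ q) 1ℚ

χ-++ : ∀ ε r L M → χ ε r (L ++ M) ≡ χ ε r L ⊗ χ ε r M
χ-++ ε r []      M = sym (ℚᵒ.*-identityˡ _)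
χ-++ ε r (b ∷ L) M = trans (cong (ind (multiplicity b ≟ r) ⊗ ε ⊗_) (χ-++ ε r L M)) (sym (ℚᵒ.*-assoc _ _ _))

-- The powers of ε enter as a function `s` with its recursion, so that `[-1]^_` serves for E and the
-- constant 1 for E⁺.
χ-all : ∀ {ε r} (s : ℕ → ℚ) → s 0 ≡ 1ℚ → (∀ k → s (suc k) ≡ ε ⊗ s k) →
        ∀ {L} → All (λ b → multiplicity b ≡ r) L → χ ε r L ≡ s (length L)
χ-all s s0 ss []       = sym s0
χ-all {ε} {r} s s0 ss {b ∷ L} (p ∷ ps) = trans
  (cong₂ _⊗_ (trans (cong (_⊗ ε) (ind-true (multiplicity b ≟ r) p)) (ℚᵒ.*-identityˡ ε)) (χ-all s s0 ss ps))
  (sym (ss (length L)))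

χ-¬all : ∀ {ε r L} → ¬ All (λ b → multiplicity b ≡ r) L → χ ε r L ≡ 0ℚ
χ-¬all {L = []} ¬p = contradiction [] ¬p
χ-¬all {ε} {r} {b ∷ L} ¬p with multiplicity b ≟ r
... | yes p = trans (cong (ind (multiplicity b ≟ r) ⊗ ε ⊗_) (χ-¬all (¬p ∘ (p ∷_)))) (ℚᵒ.zeroʳ _)
... | no  q = trans (cong (_⊗ χ ε r L) (trans (cong (_⊗ ε) (ind-false (multiplicity b ≟ r) q)) (ℚᵒ.zeroˡ ε))) (ℚᵒ.zeroˡ _)

-- L is the list of blocks of a monomial whose r-th root has degree D and N variables,
-- and is square-free if and only if S.
record Reduces (r : ℕ) (S : Set) (D N : ℕ) (L : List Block) : Set where
  field
    to     : S → All (λ b → multiplicity b ≡ r) L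
    from   : All (λ b → multiplicity b ≡ r) L → S
    degree≡ : S → D ≡ totalDegree L
    count≡ : N ≡ length L

reduces-++ : ∀ {r S S′ D D′ N N′ L L′} → Reduces r S D N L → Reduces r S′ D′ N′ L′ →
             Reduces r (S × S′) (D + D′) (N + N′) (L ++ L′)
reduces-++ {L = L} {L′} R R′ = record
  { to     = λ (s , s′) → All.++⁺ (R.to s) (R′.to s′)
  ; from   = λ a → R.from (All.++⁻ˡ L a) , R′.from (All.++⁻ʳ L a)
  ; degree≡ = λ (s , s′) → trans (cong₂ _+_ (R.degree≡ s) (R′.degree≡ s′)) (sym (totalDegree-++ L L′))
  ; count≡ = trans (cong₂ _+_ R.count≡ R′.count≡) (sym (length-++ L))
  }
  where
  module R  = Reduces R
  module R′ = Reduces R′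

reduces-map : ∀ {r S S′ D D′ N N′ L} → (S′ → S) → (S → S′) → D′ ≡ D → N′ ≡ N → Reduces r S D N L → Reduces r S′ D′ N′ L
reduces-map f g d n R = record
  { to = R.to ∘ f ; from = g ∘ R.from ; degree≡ = trans d ∘ R.degree≡ ∘ f ; count≡ = trans n R.count≡ }
  where module R = Reduces R

-- Write the exponent as q r. For q = 0 there is no block, for q = 1 there is one of multiplicity r,
-- and for larger q square-freeness and the condition on the multiplicity fail together. In the last
-- case the degree of the root is i q while the block still has degree i, which is why `degree≡`
-- assumes square-freeness.
reduces-entry : ∀ r .{{_ : NonZero r}} i {e} (p : r ∣ e) →
  Reduces r (quotient p ≤ 1) (i * quotient p) (length (filter nonZero? (quotient p ∷ []))) (entryBlocks i e)
reduces-entry r        i (divides 0 refl)             = record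
  { to = λ _ → [] ; from = λ _ → z≤n ; degree≡ = λ _ → *-zeroʳ i ; count≡ = refl }
reduces-entry (suc r)  i (divides 1 refl)             = record
  { to = λ _ → *-identityˡ (suc r) ∷ [] ; from = λ _ → ≤-refl ; degree≡ = λ _ → *-comm i 1 ; count≡ = refl }
reduces-entry (suc r)  i (divides (suc (suc k)) refl) = record
  { to     = λ { (s≤s ()) }
  ; from   = λ { (eq ∷ []) → contradiction eq (m+1+n≢m (suc r)) }
  ; degree≡ = λ { (s≤s ()) }
  ; count≡ = refl }

module _ (r : ℕ) .{{_ : NonZero r}} where

  reduces-row : ∀ i {es} (p : All (r ∣_) es) → let q = All.reduce quotient p in
    Reduces r (All (_≤ 1) q) (i * sum q) (length (filter nonZero? q)) (rowBlocks i es)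
  reduces-row i []       = record { to = λ _ → [] ; from = λ _ → [] ; degree≡ = λ _ → *-zeroʳ i ; count≡ = refl }
  reduces-row i (p ∷ ps) = reduces-map (λ { (s ∷ ss) → s , ss }) (λ (s , ss) → s ∷ ss) (*-distribˡ-+ i (quotient p) _)
    (trans (cong length (filter-++ nonZero? (quotient p ∷ []) _)) (length-++ (filter nonZero? (quotient p ∷ []))))
    (reduces-++ (reduces-entry r i p) (reduces-row i ps))

  reduces-monomial : ∀ i {m} (p : All (All (r ∣_)) m) → let q = All.reduce (All.reduce quotient) p in
    Reduces r (SquareFree q) (degreeFrom i q) (numVars q) (monomialBlocksFrom i m)
  reduces-monomial i []       = record { to = λ _ → [] ; from = λ _ → [] ; degree≡ = λ _ → refl ; count≡ = refl }
  reduces-monomial i (p ∷ ps) = reduces-map (λ { (s ∷ ss) → s , ss }) (λ (s , ss) → s ∷ ss) refl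
    (trans (cong length (filter-++ nonZero? (All.reduce quotient p) _)) (length-++ (filter nonZero? (All.reduce quotient p))))
    (reduces-++ (reduces-row i p) (reduces-monomial (suc i) ps))

  divides-row : ∀ i es → All (λ b → multiplicity b ≡ r) (rowBlocks i es) → All (r ∣_) es
  divides-row i []           _        = []
  divides-row i (zero ∷ es)  ps       = (r ∣0) ∷ divides-row i es ps
  divides-row i (suc e ∷ es) (p ∷ ps) = subst (r ∣_) (sym p) ∣-refl ∷ divides-row i es ps

  divides-monomial : ∀ i m → All (λ b → multiplicity b ≡ r) (monomialBlocksFrom i m) → All (All (r ∣_)) m
  divides-monomial i []       _  = []
  divides-monomial i (es ∷ m) ps = divides-row i es (All.++⁻ˡ _ ps) ∷ divides-monomial (suc i) m (All.++⁻ʳ (rowBlocks i es) ps)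

  -- An exponent not divisible by r and a repeated variable in the r-th root both show up as a block
  -- of multiplicity other than r, so `χ` vanishes in exactly the cases where the coefficient does.
  blockSeries-formula : ∀ {ε} (s : ℕ → ℚ) → s 0 ≡ 1ℚ → (∀ k → s (suc k) ≡ ε ⊗ s k) →
    ∀ F → (∀ d m → F d m ≡ (if does (squareFree? m ×-dec (deg m ≟ d)) then s (numVars m) else 0ℚ)) →
    ∀ d m → blockSeries F (d ↑ r) m ≡ ind (totalDegree (monomialBlocks m) ≟ d) ⊗ χ ε r (monomialBlocks m)
  blockSeries-formula {ε} s s0 ss F F≡ d m with All.all? (All.all? (r ∣?_)) m
  ... | no ¬p = sym (trans (cong (_ ⊗_) (χ-¬all (¬p ∘ divides-monomial 1 m))) (ℚᵒ.zeroʳ _))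
  ... | yes p = trans (F≡ d q) (helper (squareFree? q))
    where
    q = All.reduce (All.reduce quotient) p
    L = monomialBlocks m
    open Reduces (reduces-monomial 1 p)
    helper : ∀ (sf? : Dec (SquareFree q)) →
      (if does (sf? ×-dec (deg q ≟ d)) then s (numVars q) else 0ℚ) ≡ ind (totalDegree L ≟ d) ⊗ χ ε r L
    helper (no ¬sf) = sym (trans (cong (_ ⊗_) (χ-¬all (¬sf ∘ from))) (ℚᵒ.zeroʳ _))
    helper (yes sf) rewrite degree≡ sf | count≡ | χ-all {ε} {r} s s0 ss (to sf) with does (totalDegree L ≟ d)
    ... | true  = sym (ℚᵒ.*-identityˡ _)
    ... | false = sym (ℚᵒ.zeroˡ _)

[-1]^-suc : ∀ k → [-1]^ (suc k) ≡ (⊝ 1ℚ) ⊗ [-1]^ k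
[-1]^-suc k = trans (lemma k) (sym (-1*x≈-x ([-1]^ k)))
  where
  opaque
    unfolding ⊝_
    lemma : ∀ k → [-1]^ (suc k) ≡ ⊝ ([-1]^ k)
    lemma k = refl

module _ (r : ℕ) .{{_ : NonZero r}} where

  E-formula : ∀ d m → blockSeries E (d ↑ r) m ≡ ind (totalDegree (monomialBlocks m) ≟ d) ⊗ χ (⊝ 1ℚ) r (monomialBlocks m)
  E-formula = blockSeries-formula r [-1]^_ refl [-1]^-suc E λ _ _ → refl

  E⁺-formula : ∀ d m → blockSeries E⁺ (d ↑ r) m ≡ ind (totalDegree (monomialBlocks m) ≟ d) ⊗ χ 1ℚ r (monomialBlocks m)
  E⁺-formula = blockSeries-formula r (λ _ → 1ℚ) refl (λ _ → sym (ℚᵒ.*-identityˡ 1ℚ)) E⁺ λ _ _ → refl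

-- The product of the E series and the E⁺ series, degree by degree

∑-splitsℕ-pick : ∀ c t (k : ℕ → ℚ) → ∑ᵒ (splitsℕ (c + t)) (λ (a , b) → ind (c ≟ a) ⊗ k b) ≡ k t
∑-splitsℕ-pick zero    zero    k = trans (ℚᵒ.+-identityʳ _) (ℚᵒ.*-identityˡ _)
∑-splitsℕ-pick zero    (suc t) k = begin
  ∑ᵒ (splitsℕ (suc t)) (λ (a , b) → ind (0 ≟ a) ⊗ k b)
    ≡⟨ ∑-splitsℕ-suc t ⟩
  1ℚ ⊗ k (suc t) ⊕ ∑ᵒ (splitsℕ t) (λ (a , b) → 0ℚ ⊗ k b)
    ≡⟨ cong₂ _⊕_ (ℚᵒ.*-identityˡ _) (∑-zero (splitsℕ t) λ _ → ℚᵒ.zeroˡ _) ⟩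
  k (suc t) ⊕ 0ℚ
    ≡⟨ ℚᵒ.+-identityʳ _ ⟩
  k (suc t) ∎
  where open ≡-Reasoning
∑-splitsℕ-pick (suc c) t       k = begin
  ∑ᵒ (splitsℕ (suc c + t)) (λ (a , b) → ind (suc c ≟ a) ⊗ k b)
    ≡⟨ ∑-splitsℕ-suc (c + t) ⟩
  0ℚ ⊗ k (suc c + t) ⊕ ∑ᵒ (splitsℕ (c + t)) (λ (a , b) → ind (suc c ≟ suc a) ⊗ k b)
    ≡⟨ cong₂ _⊕_ (ℚᵒ.zeroˡ _) (∑-splitsℕ-pick c t k) ⟩
  0ℚ ⊕ k t
    ≡⟨ ℚᵒ.+-identityˡ _ ⟩
  k t ∎
  where open ≡-Reasoning

∑-splitsℕ-pick-> : ∀ {c e} (k : ℕ → ℚ) → e < c → ∑ᵒ (splitsℕ e) (λ (a , b) → ind (c ≟ a) ⊗ k b) ≡ 0ℚ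
∑-splitsℕ-pick-> {suc c} {zero}  k _         = trans (ℚᵒ.+-identityʳ _) (ℚᵒ.zeroˡ _)
∑-splitsℕ-pick-> {suc c} {suc e} k (s≤s e<c) = trans (∑-splitsℕ-suc e)
  (trans (cong₂ _⊕_ (ℚᵒ.zeroˡ _) (∑-splitsℕ-pick-> k e<c)) (ℚᵒ.+-identityˡ _))

data Compare (c : ℕ) : ℕ → Set where
  reaches : ∀ t → Compare c (c + t)
  short   : ∀ {e} → e < c → Compare c e

compare : ∀ c e → Compare c e
compare c e with c ≤? e
... | no  c≰e = short (≰⇒> c≰e)
... | yes c≤e with m≤n⇒∃[o]m+o≡n c≤e
...   | t , refl = reaches t

module _ (r : ℕ) where

  -- The identity ∏ (1 - x^r) ∏ (1 + x^r) = ∏ (1 - x^{2r}) at a monomial with blocks L and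
  -- splittings ps; the test function h keeps track of the degrees of the two factors.
  CancelsAt : ∀ {A : Set} → List (A × A) → (A → List Block) → List Block → Set
  CancelsAt ps B L = ∀ (h : ℕ → ℚ) →
    ∑ᵒ ps (λ (a , b) → (χ (⊝ 1ℚ) r (B a) ⊗ χ 1ℚ r (B b)) ⊗ h (totalDegree (B a) + totalDegree (B b))) ≡
    χ (⊝ 1ℚ) (2 * r) L ⊗ h (2 * totalDegree L)

  cancelsAt-[] : ∀ {A : Set} (x : A) (B : A → List Block) → B x ≡ [] → CancelsAt ((x , x) ∷ []) B []
  cancelsAt-[] x B eq h rewrite eq = trans (ℚᵒ.+-identityʳ _) (cong (_⊗ h 0) (ℚᵒ.*-identityˡ 1ℚ))

  -- The identity is multiplicative over components. The tail is tested on `h` shifted by the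
  -- degrees already collected in the head, and the head then on the resulting function; this is why
  -- `CancelsAt` quantifies over all `h`. Leaving `B`, `B′` and `B″` abstract covers both an entry
  -- in front of a row and a row in front of a monomial.
  cancelsAt-∷ : ∀ {A : Set} {ps : List (A × A)} {qs : List (List A × List A)} {B B′ B″ L M} →
    (∀ a as → B″ (a ∷ as) ≡ B a ++ B′ as) → CancelsAt ps B L → CancelsAt qs B′ M →
    CancelsAt (cartesianProductWith (λ (a , b) (as , bs) → a ∷ as , b ∷ bs) ps qs) B″ (L ++ M)
  cancelsAt-∷ {A} {ps} {qs} {B} {B′} {B″} {L} {M} B″≡ cL cM h = begin
    ∑ᵒ (cartesianProductWith _ ps qs)
       (λ (as , bs) → (χ⁻ (B″ as) ⊗ χ⁺ (B″ bs)) ⊗ h (totalDegree (B″ as) + totalDegree (B″ bs)))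
      ≡⟨ ∑-cartesianProductWith _ ps qs ⟩
    ∑ᵒ ps (λ (a , b) → ∑ᵒ qs (λ (as , bs) →
       (χ⁻ (B″ (a ∷ as)) ⊗ χ⁺ (B″ (b ∷ bs))) ⊗ h (totalDegree (B″ (a ∷ as)) + totalDegree (B″ (b ∷ bs)))))
      ≡⟨ ∑-cong ps (λ (a , b) → trans (∑-cong qs λ (as , bs) → factorise a b as bs) (sym (*-∑ (χ⁻ (B a) ⊗ χ⁺ (B b)) qs))) ⟩
    ∑ᵒ ps (λ (a , b) → (χ⁻ (B a) ⊗ χ⁺ (B b)) ⊗ ∑ᵒ qs (λ (as , bs) →
       (χ⁻ (B′ as) ⊗ χ⁺ (B′ bs)) ⊗ h (totalDegree (B a) + totalDegree (B b) + (totalDegree (B′ as) + totalDegree (B′ bs)))))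
      ≡⟨ ∑-cong ps (λ (a , b) → cong (χ⁻ (B a) ⊗ χ⁺ (B b) ⊗_) (cM λ k → h (totalDegree (B a) + totalDegree (B b) + k))) ⟩
    ∑ᵒ ps (λ (a , b) → (χ⁻ (B a) ⊗ χ⁺ (B b)) ⊗ (χ⁼ M ⊗ h (totalDegree (B a) + totalDegree (B b) + 2 * totalDegree M)))
      ≡⟨ cL (λ k → χ⁼ M ⊗ h (k + 2 * totalDegree M)) ⟩
    χ⁼ L ⊗ (χ⁼ M ⊗ h (2 * totalDegree L + 2 * totalDegree M))
      ≡⟨ ℚᵒ.*-assoc (χ⁼ L) (χ⁼ M) _ ⟨
    (χ⁼ L ⊗ χ⁼ M) ⊗ h (2 * totalDegree L + 2 * totalDegree M)
      ≡⟨ cong₂ (λ q k → q ⊗ h k) (χ-++ _ (2 * r) L M) (trans (cong (2 *_) (totalDegree-++ L M)) (*-distribˡ-+ 2 (totalDegree L) _)) ⟨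
    χ⁼ (L ++ M) ⊗ h (2 * totalDegree (L ++ M)) ∎
    where
    open ≡-Reasoning
    χ⁻ = χ (⊝ 1ℚ) r
    χ⁺ = χ 1ℚ r
    χ⁼ = χ (⊝ 1ℚ) (2 * r)
    factorise : ∀ a b as bs →
      (χ⁻ (B″ (a ∷ as)) ⊗ χ⁺ (B″ (b ∷ bs))) ⊗ h (totalDegree (B″ (a ∷ as)) + totalDegree (B″ (b ∷ bs))) ≡
      (χ⁻ (B a) ⊗ χ⁺ (B b)) ⊗ ((χ⁻ (B′ as) ⊗ χ⁺ (B′ bs)) ⊗ h (totalDegree (B a) + totalDegree (B b) + (totalDegree (B′ as) + totalDegree (B′ bs))))
    factorise a b as bs rewrite B″≡ a as | B″≡ b bs | χ-++ (⊝ 1ℚ) r (B a) (B′ as) | χ-++ 1ℚ r (B b) (B′ bs)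
      | totalDegree-++ (B a) (B′ as) | totalDegree-++ (B b) (B′ bs) = trans
      (cong₂ (λ q k → q ⊗ h k) (*-interchange (χ⁻ (B a)) _ _ _) (+-interchangeℕ (totalDegree (B a)) _ _ _))
      (ℚᵒ.*-assoc (χ⁻ (B a) ⊗ χ⁺ (B b)) _ _)

-- Only splittings of x^e with both halves in {1, x^r} survive, and the two of x^r cancel.
cancelsAt-entry : ∀ r .{{_ : NonZero r}} i e → CancelsAt r (splitsℕ e) (entryBlocks i) (entryBlocks i e)
cancelsAt-entry r       i zero    = cancelsAt-[] r 0 (entryBlocks i) refl
cancelsAt-entry (suc r) i (suc e) h = begin
  ∑ᵒ (splitsℕ (suc e)) (λ (a , b) → (χ⁻ (B a) ⊗ χ⁺ (B b)) ⊗ h (totalDegree (B a) + totalDegree (B b)))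
    ≡⟨ ∑-splitsℕ-suc e ⟩
  (1ℚ ⊗ χ⁺ (B (suc e))) ⊗ h (i + 0)
    ⊕ ∑ᵒ (splitsℕ e) (λ (a , b) → (χ⁻ (B (suc a)) ⊗ χ⁺ (B b)) ⊗ h (i + 0 + totalDegree (B b)))
    ≡⟨ cong₂ _⊕_ (cong (_⊗ h (i + 0)) (trans (ℚᵒ.*-identityˡ _) (χ⁺-entry e))) (trans (∑-cong (splitsℕ e) λ (a , b) → pull a b) (sym (*-∑ (⊝ 1ℚ) (splitsℕ e)))) ⟩
  ind (suc e ≟ suc r) ⊗ h (i + 0) ⊕ (⊝ 1ℚ) ⊗ ∑ᵒ (splitsℕ e) (λ (a , b) → ind (r ≟ a) ⊗ k b)
    ≡⟨ finish (compare r e) ⟩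
  ((ind (suc e ≟ 2 * suc r) ⊗ ⊝ 1ℚ) ⊗ 1ℚ) ⊗ h (2 * (i + 0)) ∎
  where
  open ≡-Reasoning
  B = entryBlocks i
  χ⁻ = χ (⊝ 1ℚ) (suc r)
  χ⁺ = χ 1ℚ (suc r)
  k : ℕ → ℚ
  k b = χ⁺ (B b) ⊗ h (i + 0 + totalDegree (B b))
  χ⁺-entry : ∀ e → χ⁺ (B (suc e)) ≡ ind (suc e ≟ suc r)
  χ⁺-entry e = trans (ℚᵒ.*-identityʳ _) (ℚᵒ.*-identityʳ _)
  pull : ∀ a b → (χ⁻ (B (suc a)) ⊗ χ⁺ (B b)) ⊗ h (i + 0 + totalDegree (B b)) ≡ (⊝ 1ℚ) ⊗ (ind (r ≟ a) ⊗ k b)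
  pull a b = begin
    (((ind (suc a ≟ suc r) ⊗ ⊝ 1ℚ) ⊗ 1ℚ) ⊗ χ⁺ (B b)) ⊗ h′  ≡⟨ ℚᵒ.*-assoc _ _ h′ ⟩
    ((ind (suc a ≟ suc r) ⊗ ⊝ 1ℚ) ⊗ 1ℚ) ⊗ k b              ≡⟨ cong (_⊗ k b) (trans (ℚᵒ.*-identityʳ _) (ℚᵒ.*-comm _ (⊝ 1ℚ))) ⟩
    ((⊝ 1ℚ) ⊗ ind (suc a ≟ suc r)) ⊗ k b                    ≡⟨ ℚᵒ.*-assoc _ _ (k b) ⟩
    (⊝ 1ℚ) ⊗ (ind (suc a ≟ suc r) ⊗ k b)                    ≡⟨ cong (λ q → (⊝ 1ℚ) ⊗ (q ⊗ k b)) (ind-cong (suc a ≟ suc r) (r ≟ a) (λ { refl → refl }) (λ { refl → refl })) ⟩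
    (⊝ 1ℚ) ⊗ (ind (r ≟ a) ⊗ k b)                            ∎
    where h′ = h (i + 0 + totalDegree (B b))
  finish : ∀ {e} → Compare r e →
    ind (suc e ≟ suc r) ⊗ h (i + 0) ⊕ (⊝ 1ℚ) ⊗ ∑ᵒ (splitsℕ e) (λ (a , b) → ind (r ≟ a) ⊗ k b) ≡
    ((ind (suc e ≟ 2 * suc r) ⊗ ⊝ 1ℚ) ⊗ 1ℚ) ⊗ h (2 * (i + 0))
  finish {e} (short e<r) = begin
    ind (suc e ≟ suc r) ⊗ h (i + 0) ⊕ (⊝ 1ℚ) ⊗ ∑ᵒ (splitsℕ e) (λ (a , b) → ind (r ≟ a) ⊗ k b)
      ≡⟨ cong₂ (λ p q → p ⊗ h (i + 0) ⊕ (⊝ 1ℚ) ⊗ q) (ind-false (suc e ≟ suc r) (<⇒≢ (s≤s e<r))) (∑-splitsℕ-pick-> k e<r) ⟩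
    0ℚ ⊗ h (i + 0) ⊕ (⊝ 1ℚ) ⊗ 0ℚ
      ≡⟨ trans (cong₂ _⊕_ (ℚᵒ.zeroˡ _) (ℚᵒ.zeroʳ _)) (ℚᵒ.+-identityʳ 0ℚ) ⟩
    0ℚ
      ≡⟨ vanish (<⇒≢ (<-≤-trans (s≤s e<r) (m≤m+n (suc r) _))) ⟨
    ((ind (suc e ≟ 2 * suc r) ⊗ ⊝ 1ℚ) ⊗ 1ℚ) ⊗ h (2 * (i + 0)) ∎
    where
    vanish : suc e ≢ 2 * suc r → ((ind (suc e ≟ 2 * suc r) ⊗ ⊝ 1ℚ) ⊗ 1ℚ) ⊗ h (2 * (i + 0)) ≡ 0ℚ
    vanish ne = trans (cong (λ q → ((q ⊗ ⊝ 1ℚ) ⊗ 1ℚ) ⊗ h (2 * (i + 0))) (ind-false (suc e ≟ 2 * suc r) ne))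
      (trans (cong (_⊗ h (2 * (i + 0))) (trans (ℚᵒ.*-identityʳ _) (ℚᵒ.zeroˡ _))) (ℚᵒ.zeroˡ _))
  finish (reaches zero) = begin
    ind (suc (r + 0) ≟ suc r) ⊗ h (i + 0) ⊕ (⊝ 1ℚ) ⊗ ∑ᵒ (splitsℕ (r + 0)) (λ (a , b) → ind (r ≟ a) ⊗ k b)
      ≡⟨ cong₂ (λ p q → p ⊗ h (i + 0) ⊕ (⊝ 1ℚ) ⊗ q) (ind-true (suc (r + 0) ≟ suc r) (cong suc (+-identityʳ r))) (∑-splitsℕ-pick r 0 k) ⟩
    1ℚ ⊗ h (i + 0) ⊕ (⊝ 1ℚ) ⊗ (1ℚ ⊗ h (i + 0 + 0))
      ≡⟨ cong₂ (λ p q → p ⊕ (⊝ 1ℚ) ⊗ q) (ℚᵒ.*-identityˡ _) (trans (ℚᵒ.*-identityˡ _) (cong h (+-identityʳ (i + 0)))) ⟩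
    h (i + 0) ⊕ (⊝ 1ℚ) ⊗ h (i + 0)
      ≡⟨ trans (cong (h (i + 0) ⊕_) (-1*x≈-x _)) (ℚᵒ.-‿inverseʳ _) ⟩
    0ℚ
      ≡⟨ trans (cong (λ q → ((q ⊗ ⊝ 1ℚ) ⊗ 1ℚ) ⊗ h (2 * (i + 0))) (ind-false (suc (r + 0) ≟ 2 * suc r) ne))
         (trans (cong (_⊗ h (2 * (i + 0))) (trans (ℚᵒ.*-identityʳ _) (ℚᵒ.zeroˡ _))) (ℚᵒ.zeroˡ _)) ⟨
    ((ind (suc (r + 0) ≟ 2 * suc r) ⊗ ⊝ 1ℚ) ⊗ 1ℚ) ⊗ h (2 * (i + 0)) ∎
    where
    ne : suc (r + 0) ≢ 2 * suc r
    ne eq with () ← +-cancelˡ-≡ (suc r) 0 (suc r + 0) eq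
  -- The left half takes exponent `suc r` and leaves `suc t` on the right, which survives only if
  -- `suc t` is again `suc r`, so that the whole exponent is `2 * suc r`.
  finish (reaches (suc t)) = begin
    ind (suc (r + suc t) ≟ suc r) ⊗ h (i + 0) ⊕ (⊝ 1ℚ) ⊗ ∑ᵒ (splitsℕ (r + suc t)) (λ (a , b) → ind (r ≟ a) ⊗ k b)
      ≡⟨ cong₂ (λ p q → p ⊗ h (i + 0) ⊕ (⊝ 1ℚ) ⊗ q) (ind-false (suc (r + suc t) ≟ suc r) (m+1+n≢m (suc r))) (∑-splitsℕ-pick r (suc t) k) ⟩
    0ℚ ⊗ h (i + 0) ⊕ (⊝ 1ℚ) ⊗ (χ⁺ (B (suc t)) ⊗ h (i + 0 + (i + 0)))
      ≡⟨ trans (cong (_⊕ (⊝ 1ℚ) ⊗ (χ⁺ (B (suc t)) ⊗ h (i + 0 + (i + 0)))) (ℚᵒ.zeroˡ _)) (ℚᵒ.+-identityˡ _) ⟩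
    (⊝ 1ℚ) ⊗ (χ⁺ (B (suc t)) ⊗ h (i + 0 + (i + 0)))
      ≡⟨ cong₂ (λ p q → (⊝ 1ℚ) ⊗ (p ⊗ h q)) (trans (χ⁺-entry t) same) (cong (i + 0 +_) (sym (+-identityʳ (i + 0)))) ⟩
    (⊝ 1ℚ) ⊗ (ind (suc (r + suc t) ≟ 2 * suc r) ⊗ h (2 * (i + 0)))
      ≡⟨ trans (sym (ℚᵒ.*-assoc _ _ _)) (cong (_⊗ h (2 * (i + 0))) (trans (ℚᵒ.*-comm (⊝ 1ℚ) _) (sym (ℚᵒ.*-identityʳ _)))) ⟩
    ((ind (suc (r + suc t) ≟ 2 * suc r) ⊗ ⊝ 1ℚ) ⊗ 1ℚ) ⊗ h (2 * (i + 0)) ∎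
    where
    same : ind (suc t ≟ suc r) ≡ ind (suc (r + suc t) ≟ 2 * suc r)
    same = ind-cong (suc t ≟ suc r) (suc (r + suc t) ≟ 2 * suc r)
      (λ { refl → cong (suc r +_) (sym (+-identityʳ (suc r))) })
      (λ eq → trans (+-cancelˡ-≡ (suc r) (suc t) _ eq) (+-identityʳ (suc r)))

module _ (r : ℕ) .{{_ : NonZero r}} where

  cancelsAt-row : ∀ i es → CancelsAt r (splitsList splitsℕ es) (rowBlocks i) (rowBlocks i es)
  cancelsAt-row i []       = cancelsAt-[] r [] (rowBlocks i) refl
  cancelsAt-row i (e ∷ es) = cancelsAt-∷ r {ps = splitsℕ e} {splitsList splitsℕ es} {B = entryBlocks i} {rowBlocks i} {rowBlocks i} {entryBlocks i e} {rowBlocks i es} (λ _ _ → refl)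
    (cancelsAt-entry r i e) (cancelsAt-row i es)

  cancelsAt-monomial : ∀ i m → CancelsAt r (splits m) (monomialBlocksFrom i) (monomialBlocksFrom i m)
  cancelsAt-monomial i []       = cancelsAt-[] r [] (monomialBlocksFrom i) refl
  cancelsAt-monomial i (es ∷ m) = cancelsAt-∷ r {ps = splitsList splitsℕ es} {splits m}
    {B = rowBlocks i} {monomialBlocksFrom (suc i)} {monomialBlocksFrom i} {rowBlocks i es} {monomialBlocksFrom (suc i) m} (λ _ _ → refl)
    (cancelsAt-row i es) (cancelsAt-monomial (suc i) m)

∑-splitsℕ-ind : ∀ x y d → ∑ᵒ (splitsℕ d) (λ (a , b) → ind (x ≟ a) ⊗ ind (y ≟ b)) ≡ ind (x + y ≟ d)
∑-splitsℕ-ind x y d with compare x d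
... | short d<x = trans (∑-splitsℕ-pick-> (λ b → ind (y ≟ b)) d<x)
                        (sym (ind-false (x + y ≟ d) λ eq → <⇒≱ d<x (≤-trans (m≤m+n x y) (≤-reflexive eq))))
... | reaches t = trans (∑-splitsℕ-pick x t (λ b → ind (y ≟ b)))
                        (ind-cong (y ≟ t) (x + y ≟ x + t) (cong (x +_)) (+-cancelˡ-≡ x y t))

-- The homogeneous components of (Σ_a E_{a^r}) (Σ_b E⁺_{b^r}) = Σ_c E_{c^{2r}}.
∑-E⊛E⁺ : ∀ r .{{_ : NonZero r}} d m →
  ∑ᵒ (splitsℕ d) (λ (a , b) → (blockSeries E (a ↑ r) ⊛ᵒ blockSeries E⁺ (b ↑ r)) m) ≡
  ind (2 * totalDegree (monomialBlocks m) ≟ d) ⊗ χ (⊝ 1ℚ) (2 * r) (monomialBlocks m)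
∑-E⊛E⁺ r d m = begin
  ∑ᵒ (splitsℕ d) (λ (a , b) → (blockSeries E (a ↑ r) ⊛ᵒ blockSeries E⁺ (b ↑ r)) m)
    ≡⟨ ∑-cong (splitsℕ d) (λ (a , b) → trans (⊛-∑ _ _ m) (∑-cong (splits m) λ (f , g) → regroup a b f g)) ⟩
  ∑ᵒ (splitsℕ d) (λ (a , b) → ∑ᵒ (splits m) (λ (f , g) → (χ⁻ f ⊗ χ⁺ g) ⊗ (ind (D f ≟ a) ⊗ ind (D g ≟ b))))
    ≡⟨ ∑-swap (splitsℕ d) (splits m) ⟩
  ∑ᵒ (splits m) (λ (f , g) → ∑ᵒ (splitsℕ d) (λ (a , b) → (χ⁻ f ⊗ χ⁺ g) ⊗ (ind (D f ≟ a) ⊗ ind (D g ≟ b))))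
    ≡⟨ ∑-cong (splits m) (λ (f , g) → trans (sym (*-∑ (χ⁻ f ⊗ χ⁺ g) (splitsℕ d))) (cong (χ⁻ f ⊗ χ⁺ g ⊗_) (∑-splitsℕ-ind (D f) (D g) d))) ⟩
  ∑ᵒ (splits m) (λ (f , g) → (χ⁻ f ⊗ χ⁺ g) ⊗ ind (D f + D g ≟ d))
    ≡⟨ cancelsAt-monomial r 1 m (λ k → ind (k ≟ d)) ⟩
  χ (⊝ 1ℚ) (2 * r) (monomialBlocks m) ⊗ ind (2 * D m ≟ d)
    ≡⟨ ℚᵒ.*-comm _ _ ⟩
  ind (2 * D m ≟ d) ⊗ χ (⊝ 1ℚ) (2 * r) (monomialBlocks m) ∎
  where
  open ≡-Reasoning
  D : Monomial → ℕ
  D f = totalDegree (monomialBlocks f)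
  χ⁻ χ⁺ : Monomial → ℚ
  χ⁻ f = χ (⊝ 1ℚ) r (monomialBlocks f)
  χ⁺ f = χ 1ℚ r (monomialBlocks f)
  regroup : ∀ a b f g → blockSeries E (a ↑ r) f ⊗ blockSeries E⁺ (b ↑ r) g ≡
                        (χ⁻ f ⊗ χ⁺ g) ⊗ (ind (D f ≟ a) ⊗ ind (D g ≟ b))
  regroup a b f g = begin
    blockSeries E (a ↑ r) f ⊗ blockSeries E⁺ (b ↑ r) g      ≡⟨ cong₂ _⊗_ (E-formula r a f) (E⁺-formula r b g) ⟩
    (ind (D f ≟ a) ⊗ χ⁻ f) ⊗ (ind (D g ≟ b) ⊗ χ⁺ g)       ≡⟨ *-interchange _ (χ⁻ f) _ (χ⁺ g) ⟩
    (ind (D f ≟ a) ⊗ ind (D g ≟ b)) ⊗ (χ⁻ f ⊗ χ⁺ g)       ≡⟨ ℚᵒ.*-comm _ _ ⟩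
    (χ⁻ f ⊗ χ⁺ g) ⊗ (ind (D f ≟ a) ⊗ ind (D g ≟ b))       ∎

∑-unique : ∀ {xs : List A} {x} {f : A → ℚ} → Unique xs → x ∈ xs → (∀ y → y ≢ x → f y ≡ 0ℚ) → ∑ᵒ xs f ≡ f x
∑-unique {xs = x ∷ xs} {f = f} (x∉ ∷ _) (here refl) f≡0 =
  trans (cong (f x ⊕_) (∑-zero xs λ y∈ → f≡0 _ λ { refl → All.lookup x∉ y∈ refl })) (ℚᵒ.+-identityʳ _)
∑-unique {xs = y ∷ xs} {f = f} (y∉ ∷ u) (there x∈) f≡0 =
  trans (cong₂ _⊕_ (f≡0 y (All.lookup y∉ x∈)) (∑-unique u x∈ f≡0)) (ℚᵒ.+-identityˡ _)

rowBlocks-zero : ∀ i {es} → All (_≡ 0) es → rowBlocks i es ≡ []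
rowBlocks-zero i []          = refl
rowBlocks-zero i (refl ∷ ps) = rowBlocks-zero i ps

monomialBlocks-zero : ∀ i {m} → All (All (_≡ 0)) m → monomialBlocksFrom i m ≡ []
monomialBlocks-zero i []       = refl
monomialBlocks-zero i (p ∷ ps) = cong₂ _++_ (rowBlocks-zero i p) (monomialBlocks-zero (suc i) ps)

-- The row index is a successor so that every nonzero entry contributes a positive degree.
rowBlocks-zero⁻ : ∀ i es → totalDegree (rowBlocks (suc i) es) ≡ 0 → All (_≡ 0) es
rowBlocks-zero⁻ i []         _  = []
rowBlocks-zero⁻ i (zero ∷ es) eq = refl ∷ rowBlocks-zero⁻ i es eq

monomialBlocks-zero⁻ : ∀ i m → totalDegree (monomialBlocksFrom (suc i) m) ≡ 0 → All (All (_≡ 0)) m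
monomialBlocks-zero⁻ i []       _  = []
monomialBlocks-zero⁻ i (es ∷ m) eq =
  rowBlocks-zero⁻ i es (m+n≡0⇒m≡0 _ eq′) ∷ monomialBlocks-zero⁻ (suc i) m (m+n≡0⇒n≡0 (totalDegree (rowBlocks (suc i) es)) eq′)
  where eq′ = trans (sym (totalDegree-++ (rowBlocks (suc i) es) _)) eq

-- Total degree 0 leaves no blocks, where `χ` is the empty product whatever ε and r are. Hence `one`
-- serves both as E_{0^r} and as the term of a row without doublebricks.
one-formula : ∀ ε r m → one m ≡ ind (totalDegree (monomialBlocks m) ≟ 0) ⊗ χ ε r (monomialBlocks m)
one-formula ε r m with All.all? (All.all? (_≟ 0)) m
... | yes p rewrite monomialBlocks-zero 1 p = sym (ℚᵒ.*-identityˡ 1ℚ)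
... | no ¬p = sym (trans (cong (_⊗ χ ε r (monomialBlocks m))
  (ind-false (totalDegree (monomialBlocks m) ≟ 0) (¬p ∘ monomialBlocks-zero⁻ 0 m))) (ℚᵒ.zeroˡ _))

∑-upTo-suc : ∀ n {f : ℕ → ℚ} → ∑ᵒ (upTo (suc n)) f ≡ f 0 ⊕ ∑ᵒ (upTo n) (f ∘ suc)
∑-upTo-suc n {f} = cong (f 0 ⊕_) (trans (cong (λ l → ∑ᵒ l f) (sym (map-applyUpTo (λ x → x) suc n))) (∑-map suc (upTo n)))

-- Brick lengths are enumerated by a fixed `upTo n` while d varies, so the splittings of d are
-- matched to that enumeration. The indicator discards the indices where `d ∸ suc y` has been
-- truncated.
∑-splitsℕ-upTo : ∀ d n (T : ℕ → ℕ → ℚ) → d ≤ n →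
  ∑ᵒ (splitsℕ d) (λ (a , b) → T a b) ≡ T 0 d ⊕ ∑ᵒ (upTo n) (λ y → ind (suc y ≤? d) ⊗ T (suc y) (d ∸ suc y))
∑-splitsℕ-upTo zero    n       T _ = cong (T 0 0 ⊕_) (sym (∑-zero (upTo n) λ _ → ℚᵒ.zeroˡ _))
∑-splitsℕ-upTo (suc d) (suc n) T (s≤s d≤n) = begin
  ∑ᵒ (splitsℕ (suc d)) (λ (a , b) → T a b)
    ≡⟨ ∑-splitsℕ-suc d ⟩
  T 0 (suc d) ⊕ ∑ᵒ (splitsℕ d) (λ (a , b) → T (suc a) b)
    ≡⟨ cong (T 0 (suc d) ⊕_) (∑-splitsℕ-upTo d n (T ∘ suc) d≤n) ⟩
  T 0 (suc d) ⊕ (T 1 d ⊕ ∑ᵒ (upTo n) (λ y → ind (suc y ≤? d) ⊗ T (suc (suc y)) (d ∸ suc y)))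
    ≡⟨ cong (T 0 (suc d) ⊕_) (cong₂ _⊕_ (ℚᵒ.*-identityˡ _)
         (∑-cong (upTo n) λ y → cong (_⊗ T (suc (suc y)) (d ∸ suc y)) (ind-cong (suc (suc y) ≤? suc d) (suc y ≤? d) s≤s⁻¹ s≤s))) ⟨
  T 0 (suc d) ⊕ (ind (1 ≤? suc d) ⊗ T 1 d ⊕ ∑ᵒ (upTo n) (λ y → ind (suc (suc y) ≤? suc d) ⊗ T (suc (suc y)) (suc d ∸ suc (suc y))))
    ≡⟨ cong (T 0 (suc d) ⊕_) (∑-upTo-suc n) ⟨
  T 0 (suc d) ⊕ ∑ᵒ (upTo (suc n)) (λ y → ind (suc y ≤? suc d) ⊗ T (suc y) (suc d ∸ suc y)) ∎
  where open ≡-Reasoning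

∑-listsUpTo-suc : ∀ k (xs : List A) {f : List A → ℚ} →
  ∑ᵒ (listsUpTo (suc k) xs) f ≡ f [] ⊕ ∑ᵒ xs (λ x → ∑ᵒ (listsUpTo k xs) (λ l → f (x ∷ l)))
∑-listsUpTo-suc k xs {f} = cong (f [] ⊕_) (∑-cartesianProductWith _∷_ xs (listsUpTo k xs))

∑-listsUpTo-[] : ∀ k (xs : List A) {f : List A → ℚ} → (∀ x l → f (x ∷ l) ≡ 0ℚ) → ∑ᵒ (listsUpTo k xs) f ≡ f []
∑-listsUpTo-[] zero    xs     f≡0 = ℚᵒ.+-identityʳ _
∑-listsUpTo-[] (suc k) xs {f} f≡0 = trans (∑-listsUpTo-suc k xs)
  (trans (cong (f [] ⊕_) (∑-zero xs λ {x} _ → ∑-zero (listsUpTo k xs) λ {l} _ → f≡0 x l)) (ℚᵒ.+-identityʳ _))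

-- Expansion over tabloids

atMostOneDouble? : Decidable AtMostOneDouble
atMostOneDouble? ρ = length (doublebricks ρ) ≤? 1

-- The indicator kills every tabloid with two doublebricks in a row. Sums can thus run over all
-- tabloids, where they factor over rows, and be restricted to `PTdoub` only at the end.
weight : List Row → ℚ
weight rs = ind (All.all? atMostOneDouble? rs) ⊗ [-1]^ (sum (map (length ∘ bricks) rs))

[-1]^-+ : ∀ a b → [-1]^ (a + b) ≡ [-1]^ a ⊗ [-1]^ b
[-1]^-+ zero    b = sym (ℚᵒ.*-identityˡ _)
[-1]^-+ (suc a) b = begin
  [-1]^ (suc (a + b))                   ≡⟨ [-1]^-suc (a + b) ⟩
  (⊝ 1ℚ) ⊗ [-1]^ (a + b)                ≡⟨ cong ((⊝ 1ℚ) ⊗_) ([-1]^-+ a b) ⟩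
  (⊝ 1ℚ) ⊗ ([-1]^ a ⊗ [-1]^ b)          ≡⟨ ℚᵒ.*-assoc (⊝ 1ℚ) _ _ ⟨
  ((⊝ 1ℚ) ⊗ [-1]^ a) ⊗ [-1]^ b          ≡⟨ cong (_⊗ [-1]^ b) ([-1]^-suc a) ⟨
  [-1]^ (suc a) ⊗ [-1]^ b               ∎
  where open ≡-Reasoning

ind-all-++ : ∀ {P : A → Set} (P? : Decidable P) xs ys → ind (All.all? P? (xs ++ ys)) ≡ ind (All.all? P? xs) ⊗ ind (All.all? P? ys)
ind-all-++ P? []       ys = sym (ℚᵒ.*-identityˡ _)
ind-all-++ P? (x ∷ xs) ys = begin
  ind (All.all? P? (x ∷ xs ++ ys))
    ≡⟨ ind-∧ (All.all? P? (x ∷ xs ++ ys)) (P? x) (All.all? P? (xs ++ ys)) refl ⟩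
  ind (P? x) ⊗ ind (All.all? P? (xs ++ ys))
    ≡⟨ cong (ind (P? x) ⊗_) (ind-all-++ P? xs ys) ⟩
  ind (P? x) ⊗ (ind (All.all? P? xs) ⊗ ind (All.all? P? ys))
    ≡⟨ ℚᵒ.*-assoc _ _ _ ⟨
  (ind (P? x) ⊗ ind (All.all? P? xs)) ⊗ ind (All.all? P? ys)
    ≡⟨ cong (_⊗ ind (All.all? P? ys)) (ind-∧ (All.all? P? (x ∷ xs)) (P? x) (All.all? P? xs) refl) ⟨
  ind (All.all? P? (x ∷ xs)) ⊗ ind (All.all? P? ys) ∎
  where open ≡-Reasoning

weight-++ : ∀ rs ss → weight (rs ++ ss) ≡ weight rs ⊗ weight ss
weight-++ rs ss = trans
  (cong₂ _⊗_ (ind-all-++ atMostOneDouble? rs ss)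
    (trans (cong [-1]^_ (trans (cong sum (map-++ (length ∘ bricks) rs ss)) (sum-++ (map (length ∘ bricks) rs) _)))
           ([-1]^-+ (sum (map (length ∘ bricks) rs)) _)))
  (*-interchange _ _ _ _)

term : List Row → List Block → Series
term rs bs = weight rs • blockProduct E bs

term-⊛ : ∀ rs ss bs cs → term rs bs ⊛ᵒ term ss cs ≈ term (rs ++ ss) (bs ++ cs)
term-⊛ rs ss bs cs = ≈-trans (•-⊛-• (weight rs) (weight ss) _ _)
  (•-cong (sym (weight-++ rs ss)) (≈-sym (blockProduct-++ E bs cs)))

rowTerm : ℕ → Row → Series
rowTerm r ρ = term (ρ ∷ []) (rowContent r ρ)

rowTerm-∷ : ∀ r a as bs → rowTerm r (row (a ∷ as) bs) ≈ (⊝ 1ℚ) • (blockSeries E (a ↑ r) ⊛ᵒ rowTerm r (row as bs))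
rowTerm-∷ r a as bs m = begin
  weight (row (a ∷ as) bs ∷ []) ⊗ (Eₐ ⊛ᵒ P) m
    ≡⟨ cong (_⊗ (Eₐ ⊛ᵒ P) m) (trans (cong (ind (All.all? atMostOneDouble? (row as bs ∷ [])) ⊗_) ([-1]^-suc (length as + 0))) (*-leftComm _ (⊝ 1ℚ) _)) ⟩
  ((⊝ 1ℚ) ⊗ weight (row as bs ∷ [])) ⊗ (Eₐ ⊛ᵒ P) m
    ≡⟨ ℚᵒ.*-assoc (⊝ 1ℚ) _ _ ⟩
  (⊝ 1ℚ) ⊗ (weight (row as bs ∷ []) ⊗ (Eₐ ⊛ᵒ P) m)
    ≡⟨ cong ((⊝ 1ℚ) ⊗_) (⊛-• (weight (row as bs ∷ [])) Eₐ P m) ⟨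
  (⊝ 1ℚ) ⊗ (Eₐ ⊛ᵒ rowTerm r (row as bs)) m ∎
  where
  open ≡-Reasoning
  Eₐ = blockSeries E (a ↑ r)
  P  = blockProduct E (rowContent r (row as bs))

range : ℕ → List ℕ
range n = map suc (upTo n)

-- The component of degree d of Σ_c E_{c^{2r}}.
doubled : ℕ → ℕ → Series
doubled r d m = ind (2 * totalDegree (monomialBlocks m) ≟ d) ⊗ χ (⊝ 1ℚ) (2 * r) (monomialBlocks m)

module _ (r : ℕ) .{{_ : NonZero r}} where

  private instance
    2r≢0 : NonZero (2 * r)
    2r≢0 = m*n≢0 2 r

  module _ (n : ℕ) where

    coveringTerm : ℕ → List ℕ → List ℕ → Series
    coveringTerm d as bs = ind (covers? d (row as bs)) • rowTerm r (row as bs)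

    doublebrickSum : ℕ → Series
    doublebrickSum d = ∑ˢ (listsUpTo n (range n)) (coveringTerm d [])

    -- `k` bounds the number of bricks and drops when one is removed. `n` bounds the lengths and the
    -- doublebrick lists and stays fixed, since removing a brick shortens the row but does not
    -- change what is enumerated. Setting k = n = d gives the candidates in `rowTilings d`.
    rowSum : ℕ → ℕ → Series
    rowSum k d = ∑ˢ (listsUpTo k (range n)) λ as → ∑ˢ (listsUpTo n (range n)) (coveringTerm d as)

    ∑-doublebricks : ∀ k xs {f : List ℕ → ℚ} → (∀ x y l → f (x ∷ y ∷ l) ≡ 0ℚ) →
      ∑ᵒ (listsUpTo (suc k) xs) f ≡ f [] ⊕ ∑ᵒ xs (λ x → f (x ∷ []))
    ∑-doublebricks k xs {f} f≡0 = trans (∑-listsUpTo-suc k xs)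
      (cong (f [] ⊕_) (∑-cong xs λ x → ∑-listsUpTo-[] k xs (f≡0 x)))

    -- Without bricks, only the empty list and the single doublebricks have nonzero weight. A
    -- doublebrick of half-length b filling d = 2 b cells gives E_{b^{2r}}, and the empty list plays
    -- the part of b = 0.
    doublebrickSum≈ : ∀ {d} → d ≤ n → doublebrickSum d ≈ doubled r d
    doublebrickSum≈ {d} d≤n m = begin
      ∑ᵒ (listsUpTo n (range n)) (λ bs → coveringTerm d [] bs m)
        ≡⟨ truncate n ⟩
      coveringTerm d [] [] m ⊕ ∑ᵒ (range n) (λ b → coveringTerm d [] (b ∷ []) m)
        ≡⟨ cong₂ _⊕_ empty (trans (∑-map suc (upTo n)) (∑-cong (upTo n) single)) ⟩
      g 0 ⊕ ∑ᵒ (upTo n) (g ∘ suc)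
        ≡⟨ ∑-upTo-suc n ⟨
      ∑ᵒ (upTo (suc n)) g
        ≡⟨ pick (2 * c ≟ d) ⟩
      ind (2 * c ≟ d) ⊗ X ∎
      where
      open ≡-Reasoning
      c = totalDegree (monomialBlocks m)
      X = χ (⊝ 1ℚ) (2 * r) (monomialBlocks m)
      -- The contribution of half-length y, with y = 0 for no doublebrick. At the monomial m only y
      -- = c can survive, and 2 c = d ≤ n keeps it in range.
      g : ℕ → ℚ
      g y = ind (2 * y ≟ d) ⊗ (ind (c ≟ y) ⊗ X)
      zero-weight : ∀ x y l → coveringTerm d [] (x ∷ y ∷ l) m ≡ 0ℚ
      zero-weight x y l = trans (cong (λ q → ind (covers? d (row [] (x ∷ y ∷ l))) ⊗ (q ⊗ blockProduct E (rowContent r (row [] (x ∷ y ∷ l))) m)) (ℚᵒ.zeroˡ 1ℚ))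
        (trans (cong (_ ⊗_) (ℚᵒ.zeroˡ _)) (ℚᵒ.zeroʳ _))
      truncate : ∀ n′ → ∑ᵒ (listsUpTo n′ (range n′)) (λ bs → coveringTerm d [] bs m) ≡
                     coveringTerm d [] [] m ⊕ ∑ᵒ (range n′) (λ b → coveringTerm d [] (b ∷ []) m)
      truncate zero    = refl
      truncate (suc n) = ∑-doublebricks n (range (suc n)) zero-weight
      empty : coveringTerm d [] [] m ≡ g 0
      empty = cong₂ _⊗_ (ind-cong (covers? d (row [] [])) (0 ≟ d) proj₂ (λ eq → ([] , []) , eq))
        (trans (cong (_⊗ one m) (ℚᵒ.*-identityˡ 1ℚ)) (trans (ℚᵒ.*-identityˡ _) (one-formula (⊝ 1ℚ) (2 * r) m)))
      single : ∀ y → coveringTerm d [] (suc y ∷ []) m ≡ g (suc y)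
      single y = cong₂ _⊗_
        (ind-cong (covers? d (row [] (suc y ∷ []))) (2 * suc y ≟ d)
          (λ (_ , eq) → trans (cong (2 *_) (sym (+-identityʳ (suc y)))) eq)
          (λ eq → ([] , _ ∷ []) , trans (cong (2 *_) (+-identityʳ (suc y))) eq))
        (trans (cong (_⊗ (blockSeries E (suc y ↑ (2 * r)) ⊛ᵒ one) m) (ℚᵒ.*-identityˡ 1ℚ))
        (trans (ℚᵒ.*-identityˡ _)
        (trans (⊛-comm (blockSeries E (suc y ↑ (2 * r))) one m)
        (trans (⊛-identityˡ (blockSeries E (suc y ↑ (2 * r))) m) (E-formula (2 * r) (suc y) m)))))
      pick : Dec (2 * c ≡ d) → ∑ᵒ (upTo (suc n)) g ≡ ind (2 * c ≟ d) ⊗ X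
      pick (yes eq) = begin
        ∑ᵒ (upTo (suc n)) g
          ≡⟨ ∑-unique (Unique.upTo⁺ (suc n)) (∈-upTo⁺ (s≤s (≤-trans (m≤m+n c _) (≤-trans (≤-reflexive eq) d≤n))))
               (λ y y≢c → trans (cong (λ q → ind (2 * y ≟ d) ⊗ (q ⊗ X)) (ind-false (c ≟ y) (y≢c ∘ sym))) (trans (cong (_ ⊗_) (ℚᵒ.zeroˡ X)) (ℚᵒ.zeroʳ _))) ⟩
        ind (2 * c ≟ d) ⊗ (ind (c ≟ c) ⊗ X)
          ≡⟨ cong (ind (2 * c ≟ d) ⊗_) (trans (cong (_⊗ X) (ind-true (c ≟ c) refl)) (ℚᵒ.*-identityˡ X)) ⟩
        ind (2 * c ≟ d) ⊗ X ∎
      pick (no ne) = trans (∑-zero (upTo (suc n)) λ {y} _ → vanish y (c ≟ y))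
        (sym (trans (cong (_⊗ X) (ind-false (2 * c ≟ d) ne)) (ℚᵒ.zeroˡ X)))
        where
        vanish : ∀ y → Dec (c ≡ y) → g y ≡ 0ℚ
        vanish y (yes refl) = trans (cong (_⊗ (ind (c ≟ c) ⊗ X)) (ind-false (2 * c ≟ d) ne)) (ℚᵒ.zeroˡ _)
        vanish y (no c≢y)   = trans (cong (λ q → ind (2 * y ≟ d) ⊗ (q ⊗ X)) (ind-false (c ≟ y) c≢y)) (trans (cong (_ ⊗_) (ℚᵒ.zeroˡ X)) (ℚᵒ.zeroʳ _))

    -- The removed brick leaves behind a factor E and a sign. Without the indicator, a brick longer
    -- than the row would wrongly be completed by tilings of 0 cells.
    firstBrick : ∀ k d y m →
      ∑ᵒ (listsUpTo k (range n)) (λ as → ∑ᵒ (listsUpTo n (range n)) (λ bs → coveringTerm d (suc y ∷ as) bs m)) ≡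
      (⊝ 1ℚ) ⊗ (ind (suc y ≤? d) ⊗ (blockSeries E (suc y ↑ r) ⊛ᵒ rowSum k (d ∸ suc y)) m)
    firstBrick k d y m = begin
      ∑ᵒ K (λ as → ∑ᵒ N (λ bs → coveringTerm d (suc y ∷ as) bs m))
        ≡⟨ ∑-cong K (λ as → ∑-cong N λ bs → split as bs (suc y ≤? d)) ⟩
      ∑ᵒ K (λ as → ∑ᵒ N (λ bs → q ⊗ (Eₐ ⊛ᵒ coveringTerm (d ∸ suc y) as bs) m))
        ≡⟨ ∑-cong K (λ as → *-∑ q N) ⟨
      ∑ᵒ K (λ as → q ⊗ ∑ᵒ N (λ bs → (Eₐ ⊛ᵒ coveringTerm (d ∸ suc y) as bs) m))
        ≡⟨ *-∑ q K ⟨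
      q ⊗ ∑ᵒ K (λ as → ∑ᵒ N (λ bs → (Eₐ ⊛ᵒ coveringTerm (d ∸ suc y) as bs) m))
        ≡⟨ cong (q ⊗_) (∑-cong K λ as → ⊛-∑ˢ N Eₐ (coveringTerm (d ∸ suc y) as) m) ⟨
      q ⊗ ∑ᵒ K (λ as → (Eₐ ⊛ᵒ ∑ˢ N (coveringTerm (d ∸ suc y) as)) m)
        ≡⟨ cong (q ⊗_) (⊛-∑ˢ K Eₐ (λ as → ∑ˢ N (coveringTerm (d ∸ suc y) as)) m) ⟨
      q ⊗ (Eₐ ⊛ᵒ rowSum k (d ∸ suc y)) m
        ≡⟨ ℚᵒ.*-assoc (⊝ 1ℚ) _ _ ⟩
      (⊝ 1ℚ) ⊗ (ind (suc y ≤? d) ⊗ (Eₐ ⊛ᵒ rowSum k (d ∸ suc y)) m) ∎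
      where
      open ≡-Reasoning
      K = listsUpTo k (range n)
      N = listsUpTo n (range n)
      q = (⊝ 1ℚ) ⊗ ind (suc y ≤? d)
      Eₐ = blockSeries E (suc y ↑ r)
      split : ∀ as bs → Dec (suc y ≤ d) → coveringTerm d (suc y ∷ as) bs m ≡ q ⊗ (Eₐ ⊛ᵒ coveringTerm (d ∸ suc y) as bs) m
      split as bs (no y≰d) = begin
        ind (covers? d (row (suc y ∷ as) bs)) ⊗ _
          ≡⟨ cong (_⊗ rowTerm r (row (suc y ∷ as) bs) m) (ind-false (covers? d (row (suc y ∷ as) bs))
               λ (_ , eq) → y≰d (≤-trans (m≤m+n (suc y) _) (≤-reflexive (trans (sym (+-assoc (suc y) (sum as) _)) eq)))) ⟩
        0ℚ ⊗ rowTerm r (row (suc y ∷ as) bs) m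
          ≡⟨ ℚᵒ.zeroˡ _ ⟩
        0ℚ
          ≡⟨ trans (cong (_⊗ T) (trans (cong ((⊝ 1ℚ) ⊗_) (ind-false (suc y ≤? d) y≰d)) (ℚᵒ.zeroʳ _))) (ℚᵒ.zeroˡ _) ⟨
        q ⊗ T ∎
        where T = (Eₐ ⊛ᵒ coveringTerm (d ∸ suc y) as bs) m
      split as bs (yes y≤d) = begin
        ind (covers? d (row (suc y ∷ as) bs)) ⊗ rowTerm r (row (suc y ∷ as) bs) m
          ≡⟨ cong₂ _⊗_ (ind-cong (covers? d (row (suc y ∷ as) bs)) (covers? (d ∸ suc y) (row as bs)) to from) (rowTerm-∷ r (suc y) as bs m) ⟩
        i ⊗ ((⊝ 1ℚ) ⊗ (Eₐ ⊛ᵒ rowTerm r (row as bs)) m)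
          ≡⟨ *-leftComm i (⊝ 1ℚ) _ ⟩
        (⊝ 1ℚ) ⊗ (i ⊗ (Eₐ ⊛ᵒ rowTerm r (row as bs)) m)
          ≡⟨ cong₂ _⊗_ (trans (sym (ℚᵒ.*-identityʳ _)) (cong ((⊝ 1ℚ) ⊗_) (sym (ind-true (suc y ≤? d) y≤d)))) (sym (⊛-• i Eₐ (rowTerm r (row as bs)) m)) ⟩
        q ⊗ (Eₐ ⊛ᵒ coveringTerm (d ∸ suc y) as bs) m ∎
        where
        i = ind (covers? (d ∸ suc y) (row as bs))
        assoc : sum (suc y ∷ as) + 2 * sum bs ≡ suc y + (sum as + 2 * sum bs)
        assoc = +-assoc (suc y) (sum as) _
        to : Covers d (row (suc y ∷ as) bs) → Covers (d ∸ suc y) (row as bs)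
        to ((_ ∷ as>0 , bs>0) , eq) = (as>0 , bs>0) ,
          trans (sym (m+n∸m≡n (suc y) _)) (cong (_∸ suc y) (trans (sym assoc) eq))
        from : Covers (d ∸ suc y) (row as bs) → Covers d (row (suc y ∷ as) bs)
        from ((as>0 , bs>0) , eq) = (_ ∷ as>0 , bs>0) , trans assoc (trans (cong (suc y +_) eq) (m+[n∸m]≡n y≤d))

    -- With R = Σ_d rowSum d, removing the first brick gives R = Σ_c E_{c^{2r}} - (Σ_{a ≥ 1} E_{a^r}) R.
    rowSum≈ : ∀ k d → d ≤ k → d ≤ n → rowSum k d ≈ blockSeries E⁺ (d ↑ r)
    rowSum≈ k d d≤k d≤n m = begin
      rowSum k d m
        ≡⟨ unfold k d≤k ⟩
      doubled r d m ⊕ (⊝ 1ℚ) ⊗ S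
        -- `doubled r d` is the full convolution of E with E⁺. Its terms with a ≥ 1 are exactly the
        -- sum `S` being subtracted, so only the term a = 0 is left.
        ≡⟨ cong (_⊕ (⊝ 1ℚ) ⊗ S) (trans (sym (∑-E⊛E⁺ r d m)) (∑-splitsℕ-upTo d n T d≤n)) ⟩
      (T 0 d ⊕ S) ⊕ (⊝ 1ℚ) ⊗ S
        ≡⟨ ℚᵒ.+-assoc (T 0 d) S _ ⟩
      T 0 d ⊕ (S ⊕ (⊝ 1ℚ) ⊗ S)
        ≡⟨ cong (T 0 d ⊕_) (trans (cong (S ⊕_) (-1*x≈-x S)) (ℚᵒ.-‿inverseʳ S)) ⟩
      T 0 d ⊕ 0ℚ
        ≡⟨ ℚᵒ.+-identityʳ _ ⟩
      (blockSeries E (0 ↑ r) ⊛ᵒ blockSeries E⁺ (d ↑ r)) m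
        ≡⟨ ⊛-cong {G = blockSeries E⁺ (d ↑ r)} (λ f → trans (E-formula r 0 f) (sym (one-formula (⊝ 1ℚ) r f))) ≈-refl m ⟩
      (one ⊛ᵒ blockSeries E⁺ (d ↑ r)) m
        ≡⟨ ⊛-identityˡ _ m ⟩
      blockSeries E⁺ (d ↑ r) m ∎
      where
      open ≡-Reasoning
      T : ℕ → ℕ → ℚ
      T a b = (blockSeries E (a ↑ r) ⊛ᵒ blockSeries E⁺ (b ↑ r)) m
      S = ∑ᵒ (upTo n) (λ y → ind (suc y ≤? d) ⊗ T (suc y) (d ∸ suc y))
      unfold : ∀ k → d ≤ k → rowSum k d m ≡ doubled r d m ⊕ (⊝ 1ℚ) ⊗ S
      unfold zero z≤n = begin
        doublebrickSum 0 m ⊕ 0ℚ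
          ≡⟨ cong₂ _⊕_ (doublebrickSum≈ d≤n m) (sym (trans (cong ((⊝ 1ℚ) ⊗_) (∑-zero (upTo n) λ _ → ℚᵒ.zeroˡ _)) (ℚᵒ.zeroʳ _))) ⟩
        doubled r 0 m ⊕ (⊝ 1ℚ) ⊗ S ∎
      unfold (suc k) d≤1+k = begin
        rowSum (suc k) d m
          ≡⟨ ∑-listsUpTo-suc k (range n) ⟩
        doublebrickSum d m ⊕ ∑ᵒ (range n) (λ x → ∑ᵒ (listsUpTo k (range n)) (λ as → ∑ᵒ (listsUpTo n (range n)) (λ bs → coveringTerm d (x ∷ as) bs m)))
          ≡⟨ cong₂ _⊕_ (doublebrickSum≈ d≤n m) (trans (∑-map suc (upTo n)) (∑-cong (upTo n) λ y → firstBrick k d y m)) ⟩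
        doubled r d m ⊕ ∑ᵒ (upTo n) (λ y → (⊝ 1ℚ) ⊗ (ind (suc y ≤? d) ⊗ (blockSeries E (suc y ↑ r) ⊛ᵒ rowSum k (d ∸ suc y)) m))
          -- Induction on `k`: the removed brick has at least one cell, so at most `k` cells remain.
          ≡⟨ cong (doubled r d m ⊕_) (∑-cong (upTo n) λ y → cong ((⊝ 1ℚ) ⊗_) (cong (ind (suc y ≤? d) ⊗_)
               (⊛-cong {F = blockSeries E (suc y ↑ r)} ≈-refl (rowSum≈ k (d ∸ suc y) (smaller y) (≤-trans (m∸n≤m d (suc y)) d≤n)) m))) ⟩
        doubled r d m ⊕ ∑ᵒ (upTo n) (λ y → (⊝ 1ℚ) ⊗ (ind (suc y ≤? d) ⊗ T (suc y) (d ∸ suc y)))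
          ≡⟨ cong (doubled r d m ⊕_) (*-∑ (⊝ 1ℚ) (upTo n)) ⟨
        doubled r d m ⊕ (⊝ 1ℚ) ⊗ S ∎
        where
        smaller : ∀ y → d ∸ suc y ≤ k
        smaller y = ≤-trans (∸-monoˡ-≤ (suc y) d≤1+k) (m∸n≤m k y)

  E⁺-row : ∀ d → blockSeries E⁺ (d ↑ r) ≈ ∑ˢ (rowTilings d) (rowTerm r ∘ value)
  E⁺-row d m = begin
    blockSeries E⁺ (d ↑ r) m
      ≡⟨ rowSum≈ d d d ≤-refl ≤-refl m ⟨
    ∑ᵒ (positiveLists d) (λ as → ∑ᵒ (positiveLists d) (λ bs → ind (covers? d (row as bs)) ⊗ rowTerm r (row as bs) m))
      ≡⟨ ∑-cartesianProductWith row (positiveLists d) (positiveLists d) ⟨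
    ∑ᵒ (cartesianProductWith row (positiveLists d) (positiveLists d)) (λ ρ → ind (covers? d ρ) ⊗ rowTerm r ρ m)
      ≡⟨ ∑-select (covers? d) (cartesianProductWith row (positiveLists d) (positiveLists d)) ⟨
    ∑ᵒ (rowTilings d) (λ ρ → rowTerm r (value ρ) m) ∎
    where open ≡-Reasoning

-- Distributivity: a product of sums is a sum over independent choices, which is what `alls`
-- enumerates. It is used once for the rows of a factor and once for the factors of a tabloid.
∑ˢ-alls-∷ : ∀ {P : A → Set} (f : ∀ x → List (P x)) x xs (G : P x → Series) (H : All P xs → Series) (K : All P (x ∷ xs) → Series) →
  (∀ p ps → G p ⊛ᵒ H ps ≈ K (p ∷ ps)) → ∑ˢ (f x) G ⊛ᵒ ∑ˢ (alls f xs) H ≈ ∑ˢ (alls f (x ∷ xs)) K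
∑ˢ-alls-∷ f x xs G H K GH≈K m = begin
  (∑ˢ (f x) G ⊛ᵒ ∑ˢ (alls f xs) H) m
    ≡⟨ ∑ˢ-⊛ (f x) G _ m ⟩
  ∑ᵒ (f x) (λ p → (G p ⊛ᵒ ∑ˢ (alls f xs) H) m)
    ≡⟨ ∑-cong (f x) (λ p → trans (⊛-∑ˢ (alls f xs) (G p) H m) (∑-cong (alls f xs) λ ps → GH≈K p ps m)) ⟩
  ∑ᵒ (f x) (λ p → ∑ᵒ (alls f xs) (λ ps → K (p ∷ ps) m))
    ≡⟨ ∑-cartesianProductWith _∷_ (f x) (alls f xs) ⟨
  ∑ᵒ (alls f (x ∷ xs)) (λ ps → K ps m) ∎
  where open ≡-Reasoning

term-[] : ∀ (x : A) → one ≈ ∑ˢ (x ∷ []) (λ _ → term [] [])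
term-[] x m = sym (trans (ℚᵒ.+-identityʳ _) (trans (cong (_⊗ one m) (ℚᵒ.*-identityˡ 1ℚ)) (ℚᵒ.*-identityˡ _)))

factorTerm : ∀ r {ds} → All RowTiling ds → Series
factorTerm r t = term (All.reduce value t) (concatMap (rowContent r) (All.reduce value t))

E⁺-factor : ∀ r .{{_ : NonZero r}} ds → blockProduct E⁺ (map (_↑ r) ds) ≈ ∑ˢ (alls rowTilings ds) (factorTerm r)
E⁺-factor r []       = term-[] {A = All RowTiling []} []
E⁺-factor r (d ∷ ds) = ≈-trans (⊛-cong (E⁺-row r d) (E⁺-factor r ds))
  (∑ˢ-alls-∷ rowTilings d ds (rowTerm r ∘ value) (factorTerm r) (factorTerm r) λ ρ t →
    term-⊛ (value ρ ∷ []) (All.reduce value t) (rowContent r (value ρ)) _)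

tabloidTerm : ∀ r {ps} → All FactorTiling ps → Series
tabloidTerm r T = term (concat (All.reduce (λ {p} → rows {p}) T)) (contentFrom r T)

E⁺-tabloid : ∀ r .{{_ : NonZero r}} ps →
  blockProduct E⁺ (blocksFrom r ps) ≈ ∑ˢ (alls (λ p → alls rowTilings (parts p)) ps) (tabloidTerm r)
E⁺-tabloid r []       = term-[] {A = All FactorTiling []} []
E⁺-tabloid r (p ∷ ps) = ≈-trans (blockProduct-++ E⁺ (map (_↑ r) (parts p)) _)
  (≈-trans (⊛-cong (E⁺-factor r (parts p)) (E⁺-tabloid (suc r) ps))
  (∑ˢ-alls-∷ (λ p → alls rowTilings (parts p)) p ps (factorTerm r) (tabloidTerm (suc r)) (tabloidTerm r) λ t T →
    term-⊛ (rows {p} t) _ (concatMap (rowContent r) (rows {p} t)) (contentFrom (suc r) T)))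

E⁺-expansion : ∀ {n} (σ : Typ n) → blockProduct E⁺ (blocks σ) ≈ ∑ˢ (tabloids σ) (λ T → term (allRows σ T) (content σ T))
E⁺-expansion σ = E⁺-tabloid 1 (factors σ)

-- Types as multisets of blocks

≥-decTotalOrder : DecTotalOrder _ _ _
≥-decTotalOrder = Flip.decTotalOrder ≤-decTotalOrder

open InsertionSortProperties ≥-decTotalOrder using (insert-↭; insert-↗)

blockWeight : List Block → ℕ
blockWeight L = sum (map (λ b → multiplicity b * degree b) L)

blockWeight-++ : ∀ L M → blockWeight (L ++ M) ≡ blockWeight L + blockWeight M
blockWeight-++ L M = trans (cong sum (map-++ _ L M)) (sum-++ (map _ L) _)

blockWeight-↭ : ∀ {L M} → L ↭ M → blockWeight L ≡ blockWeight M
blockWeight-↭ p = sum-↭ (map⁺ _ p)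

blockWeight-map : ∀ r ds → blockWeight (map (_↑ r) ds) ≡ r * sum ds
blockWeight-map r []       = sym (*-zeroʳ r)
blockWeight-map r (d ∷ ds) = trans (cong (r * d +_) (blockWeight-map r ds)) (sym (*-distribˡ-+ r d (sum ds)))

blockWeight-blocksFrom : ∀ i ps → blockWeight (blocksFrom i ps) ≡ weightFrom i ps
blockWeight-blocksFrom i []       = refl
blockWeight-blocksFrom i (p ∷ ps) = trans (blockWeight-++ (map (_↑ i) (parts p)) _)
  (cong₂ _+_ (blockWeight-map i (parts p)) (blockWeight-blocksFrom (suc i) ps))

Positive : Block → Set
Positive b = NonZero (degree b) × NonZero (multiplicity b)

positive-map : ∀ r .{{_ : NonZero r}} {ds} → All NonZero ds → All Positive (map (_↑ r) ds)
positive-map (suc r) = All.map⁺ ∘ All.map (_, _)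

positive-blocksFrom : ∀ i .{{_ : NonZero i}} ps → All Positive (blocksFrom i ps)
positive-blocksFrom i []                   = []
positive-blocksFrom i ((l , [ isP ]) ∷ ps) =
  All.++⁺ (positive-map i (proj₁ (recompute (isPartition? l) isP))) (positive-blocksFrom (suc i) ps)

module _ (r : ℕ) .{{_ : NonZero r}} where

  private instance
    2r≢0 : NonZero (2 * r)
    2r≢0 = m*n≢0 2 r

  positive-row : ∀ {d} (ρ : RowTiling d) → All Positive (rowContent r (value ρ))
  positive-row {d} (ρ , [ c ]) with recompute (covers? d ρ) c
  ... | (as>0 , bs>0) , _ = All.++⁺ (positive-map r as>0) (positive-map (2 * r) bs>0)

  -- A doublebrick of 2 b cells becomes the block of degree b and multiplicity 2 r, and 2 r · b = r
  -- · 2 b. Thus the content of a tabloid has the weight of its shape, hence is the block multiset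
  -- of a type of the same n.
  blockWeight-row : ∀ {d} (ρ : RowTiling d) → blockWeight (rowContent r (value ρ)) ≡ r * d
  blockWeight-row {d} (row as bs , [ c ]) with recompute (covers? d (row as bs)) c
  ... | _ , eq = begin
    blockWeight (map (_↑ r) as ++ map (_↑ (2 * r)) bs)  ≡⟨ blockWeight-++ (map (_↑ r) as) _ ⟩
    blockWeight (map (_↑ r) as) + blockWeight (map (_↑ (2 * r)) bs)
      ≡⟨ cong₂ _+_ (blockWeight-map r as) (trans (blockWeight-map (2 * r) bs) (trans (cong (_* sum bs) (*-comm 2 r)) (*-assoc r 2 _))) ⟩
    r * sum as + r * (2 * sum bs)                       ≡⟨ *-distribˡ-+ r (sum as) _ ⟨
    r * (sum as + 2 * sum bs)                           ≡⟨ cong (r *_) eq ⟩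
    r * d                                               ∎
    where open ≡-Reasoning

  positive-factor : ∀ {ds} (t : All RowTiling ds) → All Positive (concatMap (rowContent r) (All.reduce value t))
  positive-factor []      = []
  positive-factor (ρ ∷ t) = All.++⁺ (positive-row ρ) (positive-factor t)

  blockWeight-factor : ∀ {ds} (t : All RowTiling ds) → blockWeight (concatMap (rowContent r) (All.reduce value t)) ≡ r * sum ds
  blockWeight-factor []                = sym (*-zeroʳ r)
  blockWeight-factor {d ∷ ds} (ρ ∷ t) = trans (blockWeight-++ (rowContent r (value ρ)) _)
    (trans (cong₂ _+_ (blockWeight-row ρ) (blockWeight-factor t)) (sym (*-distribˡ-+ r d (sum ds))))

positive-content : ∀ i .{{_ : NonZero i}} {ps} (T : All FactorTiling ps) → All Positive (contentFrom i T)
positive-content i []      = []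
positive-content i (t ∷ T) = All.++⁺ (positive-factor i t) (positive-content (suc i) T)

blockWeight-content : ∀ i .{{_ : NonZero i}} {ps} (T : All FactorTiling ps) → blockWeight (contentFrom i T) ≡ weightFrom i ps
blockWeight-content i []                = refl
blockWeight-content i (_∷_ {p} t T) = trans (blockWeight-++ (concatMap (rowContent i) (rows {p} t)) _)
  (cong₂ _+_ (blockWeight-factor i t) (blockWeight-content (suc i) T))

insertPart : ∀ d .{{_ : NonZero d}} → Partition → Partition
insertPart d (l , [ isP ]) = insert ≥-decTotalOrder d l ,
  [ All-resp-↭ (↭-sym (insert-↭ d l)) (recompute (nonZero? d) it ∷ proj₁ isP) , insert-↗ d (proj₂ isP) ]

insertBlock : ∀ {n} d .{{_ : NonZero d}} k → k < n → Vec Partition n → Vec Partition n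
insertBlock d zero    (s≤s _)   (p ∷ ps) = insertPart d p ∷ ps
insertBlock d (suc k) (s≤s k<n) (p ∷ ps) = p ∷ insertBlock d k k<n ps

blocksFrom-insertBlock : ∀ {n} i d .{{_ : NonZero d}} k (k<n : k < n) v →
  blocksFrom i (toList (insertBlock d k k<n v)) ↭ d ↑ (k + i) ∷ blocksFrom i (toList v)
blocksFrom-insertBlock i d zero    (s≤s _)   (p ∷ ps) = ++⁺ʳ _ (map⁺ (_↑ i) (insert-↭ d (parts p)))
blocksFrom-insertBlock i d (suc k) (s≤s k<n) (p ∷ ps) = ↭-trans
  (++⁺ˡ (map (_↑ i) (parts p)) (subst (λ j → blocksFrom (suc i) (toList (insertBlock d k k<n ps)) ↭ d ↑ j ∷ blocksFrom (suc i) (toList ps)) (+-suc k i) (blocksFrom-insertBlock (suc i) d k k<n ps)))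
  (shift _ (map (_↑ i) (parts p)) _)

blocksFrom-empty : ∀ i n → blocksFrom i (toList (replicate n ([] , [ [] , [] ]))) ≡ []
blocksFrom-empty i zero    = refl
blocksFrom-empty i (suc n) = blocksFrom-empty (suc i) n

partitionVector : ∀ n L → All Positive L → blockWeight L ≤ n → ∃[ v ] blocksFrom 1 (toList {n = n} v) ↭ L
partitionVector n []                []             _   = replicate n _ , ↭-reflexive (blocksFrom-empty 1 n)
partitionVector n (d ↑ suc k ∷ L) ((d≢0 , _) ∷ ps) w≤n with partitionVector n L ps (≤-trans (m≤n+m _ (suc k * d)) w≤n)
... | v , v↭L = insertBlock d k k<n v ,
  ↭-trans (blocksFrom-insertBlock 1 d k k<n v) (subst (λ j → d ↑ (k + 1) ∷ blocksFrom 1 (toList v) ↭ d ↑ j ∷ L) (+-comm k 1) (↭.prep _ v↭L))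
  where
  instance _ = d≢0
  -- Component k, counted from 0, holds the blocks of multiplicity k + 1. It exists because a block
  -- of positive degree has multiplicity at most its weight, hence at most n.
  k<n : k < n
  k<n = ≤-trans (m≤m*n (suc k) d) (≤-trans (m≤m+n _ _) w≤n)

typeOf : ∀ {n} L → All Positive L → blockWeight L ≡ n → ∃[ τ ] blocks {n} τ ↭ L
typeOf {n} L pos w with partitionVector n L pos (≤-reflexive w)
... | v , v↭L = (v , [ trans (sym (blockWeight-blocksFrom 1 (toList v))) (trans (blockWeight-↭ v↭L) w) ]) , v↭L

multiplicity-blocksFrom : ∀ i ps → All (λ b → i ≤ multiplicity b) (blocksFrom i ps)
multiplicity-blocksFrom i []       = []
multiplicity-blocksFrom i (p ∷ ps) =
  All.++⁺ (All.map⁺ (All.universal (λ _ → ≤-refl) (parts p))) (All.map <⇒≤ (multiplicity-blocksFrom (suc i) ps))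

filter-blocksFrom : ∀ i p ps → filter (λ b → multiplicity b ≟ i) (blocksFrom i (p ∷ ps)) ≡ map (_↑ i) (parts p)
filter-blocksFrom i p ps = begin
  filter P? (map (_↑ i) (parts p) ++ blocksFrom (suc i) ps)
    ≡⟨ filter-++ P? (map (_↑ i) (parts p)) _ ⟩
  filter P? (map (_↑ i) (parts p)) ++ filter P? (blocksFrom (suc i) ps)
    ≡⟨ cong₂ _++_ (filter-all P? (All.map⁺ (All.universal (λ _ → refl) (parts p))))
                  (filter-none P? (All.map (λ i<j j≡i → <⇒≢ i<j (sym j≡i)) (multiplicity-blocksFrom (suc i) ps))) ⟩
  map (_↑ i) (parts p) ++ []
    ≡⟨ ++-identityʳ _ ⟩
  map (_↑ i) (parts p) ∎
  where
  open ≡-Reasoning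
  P? = λ b → multiplicity b ≟ i

partition-injective : ∀ {p q : Partition} → parts p ↭ parts q → p ≡ q
partition-injective {l , [ isP ]} {l′ , [ isQ ]} l↭l′
  with Pointwise.Pointwise-≡⇒≡ (Sorted.↗↭↗⇒≋ (DecTotalOrder.totalOrder ≥-decTotalOrder)
         (proj₂ (recompute (isPartition? l) isP)) (proj₂ (recompute (isPartition? l′) isQ)) (↭.↭⇒↭ₛ l↭l′))
... | refl = refl

++-cancelˡ-↭ : ∀ {A : Set} (xs : List A) {ys zs} → xs ++ ys ↭ xs ++ zs → ys ↭ zs
++-cancelˡ-↭ []       p = p
++-cancelˡ-↭ (x ∷ xs) p = ++-cancelˡ-↭ xs (drop-∷ p)

-- Later components have larger multiplicities, so filtering by multiplicity i recovers the parts of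
-- the first partition up to order, and a sorted list is determined by its multiset. The common
-- prefix is then cancelled.
blocksFrom-injective : ∀ i {n} (u v : Vec Partition n) → blocksFrom i (toList u) ↭ blocksFrom i (toList v) → u ≡ v
blocksFrom-injective i []      []      _   = refl
blocksFrom-injective i (p ∷ u) (q ∷ v) u↭v with partition-injective {p} {q} p↭q
  where
  degrees : ∀ l → map degree (map (_↑ i) l) ≡ l
  degrees l = trans (sym (map-∘ l)) (map-id l)
  p↭q : parts p ↭ parts q
  p↭q = ↭-trans (↭-reflexive (sym (degrees (parts p)))) (↭-trans (map⁺ degree
    (↭-trans (↭-reflexive (sym (filter-blocksFrom i p (toList u))))
    (↭-trans (filter-↭ (λ b → multiplicity b ≟ i) u↭v) (↭-reflexive (filter-blocksFrom i q (toList v))))))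
    (↭-reflexive (degrees (parts q))))
... | refl = cong (p ∷_) (blocksFrom-injective (suc i) u v (++-cancelˡ-↭ (map (_↑ i) (parts p)) u↭v))

blocks-injective : ∀ {n} {σ τ : Typ n} → blocks σ ↭ blocks τ → σ ≡ τ
blocks-injective {σ = u , _} {v , _} p with blocksFrom-injective 1 u v p
... | refl = refl

-- Collecting the tabloids by content

opaque
  unfolding _⊕_ _⊛ᵒ_

  typeSeries≡ : ∀ {n} F (τ : Typ n) → typeSeries F τ ≡ blockProduct F (blocks τ)
  typeSeries≡ F τ = refl

  linearCombination≡ : ∀ {n} c (B : Typ n → Series) m → linearCombination c B m ≡ ∑ᵒ (types n) (λ ρ → c ρ ⊗ B ρ m)
  linearCombination≡ c B m = refl

weightFrom-factors : ∀ {n} (σ : Typ n) → weightFrom 1 (factors σ) ≡ n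
weightFrom-factors {n} (_ , [ w ]) = recompute (_ ≟ n) w

tabloidSum : ∀ {n} (σ τ : Typ n) → ℚ
tabloidSum σ τ = ∑ (PTdoub σ τ) (λ T → [-1]^ (ℓ₁ σ T))

module _ {n} (σ : Typ n) where

  -- Exactly one type has the content of T as its blocks: `typeOf` gives existence and
  -- `blocks-injective` uniqueness.
  blockProduct-content : ∀ (T : Tabloid σ) m →
    blockProduct E (content σ T) m ≡ ∑ᵒ (types n) (λ ρ → ind (content σ T ↭? blocks ρ) ⊗ blockProduct E (blocks ρ) m)
  blockProduct-content T m with typeOf (content σ T) (positive-content 1 T)
    (trans (blockWeight-content 1 T) (weightFrom-factors σ))
  ... | ρ , ρ↭T = sym (begin
    ∑ᵒ (types n) f
      ≡⟨ ∑-unique (types-unique n) (types-complete ρ) (λ ρ′ ρ′≢ρ → trans (cong (_⊗ blockProduct E (blocks ρ′) m)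
           (ind-false (content σ T ↭? blocks ρ′) λ p → ρ′≢ρ (blocks-injective {σ = ρ′} {ρ} (↭-sym (↭-trans ρ↭T p))))) (ℚᵒ.zeroˡ _)) ⟩
    f ρ
      ≡⟨ trans (cong (_⊗ blockProduct E (blocks ρ) m) (ind-true (content σ T ↭? blocks ρ) (↭-sym ρ↭T))) (ℚᵒ.*-identityˡ _) ⟩
    blockProduct E (blocks ρ) m
      ≡⟨ blockProduct-↭ E ρ↭T m ⟩
    blockProduct E (content σ T) m ∎)
    where
    open ≡-Reasoning
    f : Typ n → ℚ
    f ρ = ind (content σ T ↭? blocks ρ) ⊗ blockProduct E (blocks ρ) m

  expansion : typeSeries E⁺ σ ≈ linearCombination (tabloidSum σ) (typeSeries E)
  expansion m = begin
    typeSeries E⁺ σ m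
      ≡⟨ cong (λ F → F m) (typeSeries≡ E⁺ σ) ⟩
    blockProduct E⁺ (blocks σ) m
      ≡⟨ E⁺-expansion σ m ⟩
    ∑ᵒ (tabloids σ) (λ T → weight (allRows σ T) ⊗ blockProduct E (content σ T) m)
      ≡⟨ ∑-cong (tabloids σ) (λ T → trans (cong (weight (allRows σ T) ⊗_) (blockProduct-content T m))
           (trans (*-∑ (weight (allRows σ T)) (types n)) (∑-cong (types n) λ ρ → regroup ρ T))) ⟩
    ∑ᵒ (tabloids σ) (λ T → ∑ᵒ (types n) (λ ρ → (ind (inPTdoub? σ ρ T) ⊗ [-1]^ (ℓ₁ σ T)) ⊗ blockProduct E (blocks ρ) m))
      ≡⟨ ∑-swap (tabloids σ) (types n) ⟩
    ∑ᵒ (types n) (λ ρ → ∑ᵒ (tabloids σ) (λ T → (ind (inPTdoub? σ ρ T) ⊗ [-1]^ (ℓ₁ σ T)) ⊗ blockProduct E (blocks ρ) m))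
      ≡⟨ ∑-cong (types n) (λ ρ → trans (sym (∑-* (tabloids σ) (blockProduct E (blocks ρ) m)))
           (cong₂ _⊗_ (trans (sym (∑-filter (inPTdoub? σ ρ) (tabloids σ))) (sym (∑≡∑ᵒ (PTdoub σ ρ) _)))
                      (cong (λ F → F m) (sym (typeSeries≡ E ρ))))) ⟩
    ∑ᵒ (types n) (λ ρ → tabloidSum σ ρ ⊗ typeSeries E ρ m)
      ≡⟨ linearCombination≡ (tabloidSum σ) (typeSeries E) m ⟨
    linearCombination (tabloidSum σ) (typeSeries E) m ∎
    where
    open ≡-Reasoning
    -- The indicator inside `weight` and the indicator of the content together form the membership
    -- test for `PTdoub`.
    regroup : ∀ ρ T → weight (allRows σ T) ⊗ (ind (content σ T ↭? blocks ρ) ⊗ blockProduct E (blocks ρ) m) ≡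
                      (ind (inPTdoub? σ ρ T) ⊗ [-1]^ (ℓ₁ σ T)) ⊗ blockProduct E (blocks ρ) m
    regroup ρ T = begin
      (a ⊗ s) ⊗ (c ⊗ P) ≡⟨ *-interchange a s c P ⟩
      (a ⊗ c) ⊗ (s ⊗ P) ≡⟨ cong (_⊗ (s ⊗ P)) (ind-∧ (inPTdoub? σ ρ T) (All.all? atMostOneDouble? (allRows σ T)) (content σ T ↭? blocks ρ) refl) ⟨
      ind (inPTdoub? σ ρ T) ⊗ (s ⊗ P) ≡⟨ ℚᵒ.*-assoc _ s P ⟨
      (ind (inPTdoub? σ ρ T) ⊗ s) ⊗ P ∎
      where
      a = ind (All.all? atMostOneDouble? (allRows σ T))
      s = [-1]^ (ℓ₁ σ T)
      c = ind (content σ T ↭? blocks ρ)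
      P = blockProduct E (blocks ρ) m

-- Linear independence

squares : List Block → ℕ
squares L = sum (map (λ b → degree b * degree b) L)

squares-++ : ∀ L M → squares (L ++ M) ≡ squares L + squares M
squares-++ L M = trans (cong sum (map-++ _ L M)) (sum-++ (map _ L) _)

squares-↭ : ∀ {L M} → L ↭ M → squares L ≡ squares M
squares-↭ p = sum-↭ (map⁺ _ p)

totalDegree≡0 : ∀ {L} → All (NonZero ∘ degree) L → totalDegree L ≡ 0 → L ≡ []
totalDegree≡0 []                      _  = refl
totalDegree≡0 {(suc d ↑ r) ∷ L} (_ ∷ _) ()

square-+ : ∀ a b → (a + b) * (a + b) ≡ a * a + b * b + 2 * (a * b)
square-+ = solve-∀

squares≤ : ∀ L → squares L ≤ totalDegree L * totalDegree L
squares≤ []      = z≤n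
squares≤ (b ∷ L) = begin
  degree b * degree b + squares L                               ≤⟨ +-monoʳ-≤ (degree b * degree b) (squares≤ L) ⟩
  degree b * degree b + totalDegree L * totalDegree L           ≤⟨ m≤m+n _ _ ⟩
  degree b * degree b + totalDegree L * totalDegree L + 2 * (degree b * totalDegree L)
                                                                ≡⟨ square-+ (degree b) (totalDegree L) ⟨
  (degree b + totalDegree L) * (degree b + totalDegree L)       ∎
  where open ≤-Reasoning

-- Equality forces the cross term 2 d D in (d + D)² to vanish, where D is the total degree of the
-- tail; as d is positive, D = 0 and the tail is empty.
squares≡ : ∀ {L} → All (NonZero ∘ degree) L → totalDegree L ≢ 0 → squares L ≡ totalDegree L * totalDegree L → ∃[ b ] L ≡ b ∷ []
squares≡ {[]}                _        D≢0 _  = contradiction refl D≢0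
squares≡ {b@(suc d ↑ r) ∷ L} (_ ∷ ps) _   eq = b , cong (b ∷_) (totalDegree≡0 ps (m+n≡0⇒m≡0 D (m+n≡0⇒m≡0 (suc d * D) cross≡0)))
  where
  D = totalDegree L
  bound : suc d * suc d + D * D + 2 * (suc d * D) ≤ suc d * suc d + D * D + 0
  bound = begin
    suc d * suc d + D * D + 2 * (suc d * D) ≡⟨ square-+ (suc d) D ⟨
    (suc d + D) * (suc d + D)               ≡⟨ eq ⟨
    suc d * suc d + squares L               ≤⟨ +-monoʳ-≤ (suc d * suc d) (squares≤ L) ⟩
    suc d * suc d + D * D                   ≡⟨ +-identityʳ _ ⟨
    suc d * suc d + D * D + 0               ∎
    where open ≤-Reasoning
  cross≡0 : 2 * (suc d * D) ≡ 0
  cross≡0 = n≤0⇒n≡0 (+-cancelˡ-≤ (suc d * suc d + D * D) _ _ bound)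

-- Relates the blocks of a monomial to those of two factors. A variable occurring in both factors is
-- counted once on the left and twice on the right, so equality means that the factors share no
-- variable.
Shrinks : List Block → List Block → List Block → Set
Shrinks L L₁ L₂ = squares L ≤ squares L₁ + squares L₂ × (squares L ≡ squares L₁ + squares L₂ → L ↭ L₁ ++ L₂)

+-≡-split : ∀ {a b c d} → a ≤ c → b ≤ d → a + b ≡ c + d → a ≡ c × b ≡ d
+-≡-split {a} {b} {c} {d} a≤c b≤d eq = a≡c , +-cancelˡ-≡ c b d (trans (cong (_+ b) (sym a≡c)) eq)
  where
  a≡c : a ≡ c
  a≡c = ≤-antisym a≤c (+-cancelʳ-≤ d c a (≤-trans (≤-reflexive (sym eq)) (+-monoʳ-≤ a b≤d)))

shrinks-++ : ∀ {L L₁ L₂ M M₁ M₂} → Shrinks L L₁ L₂ → Shrinks M M₁ M₂ → Shrinks (L ++ M) (L₁ ++ M₁) (L₂ ++ M₂)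
shrinks-++ {L} {L₁} {L₂} {M} {M₁} {M₂} (l≤ , l≡) (m≤ , m≡) =
  ≤-trans (≤-reflexive (squares-++ L M)) (≤-trans (+-mono-≤ l≤ m≤) (≤-reflexive (sym rearrange))) ,
  λ eq → let l , m = +-≡-split l≤ m≤ (trans (sym (squares-++ L M)) (trans eq rearrange)) in
    ↭-trans (++⁺ (l≡ l) (m≡ m)) (++-interchange L₁ L₂ M₁ M₂)
  where
  rearrange : squares (L₁ ++ M₁) + squares (L₂ ++ M₂) ≡ (squares L₁ + squares L₂) + (squares M₁ + squares M₂)
  rearrange = trans (cong₂ _+_ (squares-++ L₁ M₁) (squares-++ L₂ M₂)) (+-interchangeℕ (squares L₁) _ _ _)

∈-splitsℕ⁻ : ∀ e {a b} → (a , b) ∈ splitsℕ e → a + b ≡ e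
∈-splitsℕ⁻ zero    (here refl) = refl
∈-splitsℕ⁻ (suc e) (here refl) = refl
∈-splitsℕ⁻ (suc e) (there p) with ∈-map⁻ _ p
... | (a , b) , q , refl = cong suc (∈-splitsℕ⁻ e q)

∈-splitsℕˡ : ∀ e → (0 , e) ∈ splitsℕ e
∈-splitsℕˡ zero    = here refl
∈-splitsℕˡ (suc e) = here refl

∈-splitsℕʳ : ∀ e → (e , 0) ∈ splitsℕ e
∈-splitsℕʳ zero    = here refl
∈-splitsℕʳ (suc e) = there (∈-map⁺ _ (∈-splitsℕʳ e))

-- `shrinks` bounds the monomials that can occur, and `extract` splits off a single variable to
-- exhibit a nonzero term. `trivial` makes `extract` compositional: the variable comes from one
-- component while every other component goes wholly to the right factor.
record SplitsBlocks {A : Set} (s : List (A × A)) (B : A → List Block) (x : A) : Set where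
  field
    shrinks : ∀ {f g} → (f , g) ∈ s → Shrinks (B x) (B f) (B g)
    trivial : ∃[ z ] (z , x) ∈ s × B z ≡ []
    extract : ∀ {b} → b ∈ B x → ∃₂ λ f g → (f , g) ∈ s × B f ≡ b ∷ [] × B x ↭ b ∷ B g

splitsBlocks-[] : ∀ (x : A) (B : A → List Block) → B x ≡ [] → SplitsBlocks ((x , x) ∷ []) B x
splitsBlocks-[] x B eq = record
  { shrinks = λ { (here refl) → subst (λ L → Shrinks L L L) (sym eq) (z≤n , λ _ → ↭-refl) }
  ; trivial = x , here refl , eq
  ; extract = λ b∈ → contradiction (subst (_ ∈_) eq b∈) λ ()
  }

splitsBlocks-∷ : ∀ {ps : List (A × A)} {qs : List (List A × List A)} {B B′ B″} {x : A} {xs : List A} → (∀ a as → B″ (a ∷ as) ≡ B a ++ B′ as) →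
  SplitsBlocks ps B x → SplitsBlocks qs B′ xs →
  SplitsBlocks (cartesianProductWith (λ (a , b) (as , bs) → a ∷ as , b ∷ bs) ps qs) B″ (x ∷ xs)
splitsBlocks-∷ {A} {ps} {qs} {B} {B′} {B″} {x} {xs} B″≡ S S′ = record
  { shrinks = shrinks ; trivial = trivial ; extract = extract }
  where
  module S  = SplitsBlocks S
  module S′ = SplitsBlocks S′
  product = cartesianProductWith (λ (a , b) (as , bs) → a ∷ as , b ∷ bs) ps qs
  shrinks : ∀ {f g} → (f , g) ∈ product → Shrinks (B″ (x ∷ xs)) (B″ f) (B″ g)
  shrinks p with ∈-cartesianProductWith⁻ _ ps qs p
  ... | (a , b) , (as , bs) , p₁ , p₂ , refl rewrite B″≡ x xs | B″≡ a as | B″≡ b bs =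
    shrinks-++ {B x} {B a} {B b} {B′ xs} {B′ as} {B′ bs} (S.shrinks p₁) (S′.shrinks p₂)
  trivial : ∃[ z ] (z , x ∷ xs) ∈ product × B″ z ≡ []
  trivial with S.trivial | S′.trivial
  ... | z , p , eq | zs , ps , eqs = z ∷ zs , ∈-cartesianProductWith⁺ _ p ps , trans (B″≡ z zs) (cong₂ _++_ eq eqs)
  extract : ∀ {b} → b ∈ B″ (x ∷ xs) → ∃₂ λ f g → (f , g) ∈ product × B″ f ≡ b ∷ [] × B″ (x ∷ xs) ↭ b ∷ B″ g
  extract {b} b∈ with ∈-++⁻ (B x) (subst (b ∈_) (B″≡ x xs) b∈)
  ... | inj₁ b∈x with S.extract b∈x | S′.trivial
  ...   | f , g , p , Bf , Bx | zs , ps , eqs = f ∷ zs , g ∷ xs , ∈-cartesianProductWith⁺ _ p ps ,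
    trans (B″≡ f zs) (cong₂ _++_ Bf eqs) ,
    ↭-trans (↭-reflexive (B″≡ x xs)) (↭-trans (++⁺ʳ (B′ xs) Bx) (↭-reflexive (cong (b ∷_) (sym (B″≡ g xs)))))
  extract {b} b∈ | inj₂ b∈xs with S.trivial | S′.extract b∈xs
  ...   | z , p , eq | fs , gs , ps , Bf , Bx = z ∷ fs , x ∷ gs , ∈-cartesianProductWith⁺ _ p ps ,
    trans (B″≡ z fs) (cong₂ _++_ eq Bf) ,
    ↭-trans (↭-reflexive (B″≡ x xs)) (↭-trans (++⁺ˡ (B x) Bx) (↭-trans (shift b (B x) (B′ gs)) (↭-reflexive (cong (b ∷_) (sym (B″≡ x gs))))))

splitsBlocks-entry : ∀ i e → SplitsBlocks (splitsℕ e) (entryBlocks (suc i)) e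
splitsBlocks-entry i e = record
  { shrinks = λ {a} {b} p → subst (λ e → Shrinks (entryBlocks (suc i) e) (entryBlocks (suc i) a) (entryBlocks (suc i) b)) (∈-splitsℕ⁻ e p) (shrinks a b)
  ; trivial = 0 , ∈-splitsℕˡ e , refl
  ; extract = extract e
  }
  where
  shrinks : ∀ a b → Shrinks (entryBlocks (suc i) (a + b)) (entryBlocks (suc i) a) (entryBlocks (suc i) b)
  shrinks zero    b       = ≤-refl , λ _ → ↭-refl
  shrinks (suc a) zero    rewrite +-identityʳ a = ≤-reflexive (sym (+-identityʳ _)) , λ _ → ↭-refl
  -- The variable is shared, so its square is counted once too often on the right; the square is
  -- positive because the degree is `suc i`, and equality is impossible.
  shrinks (suc a) (suc b) = m≤m+n _ _ , λ eq → contradiction (+-cancelˡ-≡ q 0 q (trans (+-identityʳ q) eq)) λ ()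
    where q = squares (entryBlocks (suc i) 1)
  extract : ∀ e {b} → b ∈ entryBlocks (suc i) e →
    ∃₂ λ f g → (f , g) ∈ splitsℕ e × entryBlocks (suc i) f ≡ b ∷ [] × entryBlocks (suc i) e ↭ b ∷ entryBlocks (suc i) g
  extract (suc e) (here refl) = suc e , 0 , ∈-splitsℕʳ (suc e) , refl , ↭-refl

splitsBlocks-row : ∀ i es → SplitsBlocks (splitsList splitsℕ es) (rowBlocks (suc i)) es
splitsBlocks-row i []       = splitsBlocks-[] [] (rowBlocks (suc i)) refl
splitsBlocks-row i (e ∷ es) = splitsBlocks-∷ {B = entryBlocks (suc i)} {rowBlocks (suc i)} {rowBlocks (suc i)} (λ _ _ → refl)
  (splitsBlocks-entry i e) (splitsBlocks-row i es)

splitsBlocks-monomial : ∀ i m → SplitsBlocks (splits m) (monomialBlocksFrom (suc i)) m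
splitsBlocks-monomial i []       = splitsBlocks-[] [] (monomialBlocksFrom (suc i)) refl
splitsBlocks-monomial i (es ∷ m) = splitsBlocks-∷ {B = rowBlocks (suc i)} {monomialBlocksFrom (suc (suc i))} {monomialBlocksFrom (suc i)} (λ _ _ → refl)
  (splitsBlocks-row i es) (splitsBlocks-monomial (suc i) m)

rowBlocks-degree : ∀ i es → All (NonZero ∘ degree) (rowBlocks (suc i) es)
rowBlocks-degree i []           = []
rowBlocks-degree i (zero ∷ es)  = rowBlocks-degree i es
rowBlocks-degree i (suc e ∷ es) = _ ∷ rowBlocks-degree i es

monomialBlocks-degree : ∀ i m → All (NonZero ∘ degree) (monomialBlocksFrom (suc i) m)
monomialBlocks-degree i []       = []
monomialBlocks-degree i (es ∷ m) = All.++⁺ (rowBlocks-degree i es) (monomialBlocks-degree (suc i) m)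

⊗-≢0ˡ : ∀ {p q} → p ⊗ q ≢ 0ℚ → p ≢ 0ℚ
⊗-≢0ˡ {q = q} pq≢0 refl = pq≢0 (ℚᵒ.zeroˡ q)

⊗-≢0ʳ : ∀ {p q} → p ⊗ q ≢ 0ℚ → q ≢ 0ℚ
⊗-≢0ʳ {p} pq≢0 refl = pq≢0 (ℚᵒ.zeroʳ p)

∑-≢0 : ∀ (xs : List A) {f : A → ℚ} → ∑ᵒ xs f ≢ 0ℚ → ∃[ x ] x ∈ xs × f x ≢ 0ℚ
∑-≢0 []           ∑≢0 = contradiction refl ∑≢0
∑-≢0 (x ∷ xs) {f} ∑≢0 with f x ℚ.≟ 0ℚ
... | no fx≢0 = x , here refl , fx≢0
... | yes fx≡0 with ∑-≢0 xs (λ eq → ∑≢0 (trans (cong₂ _⊕_ fx≡0 eq) (ℚᵒ.+-identityˡ 0ℚ)))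
...   | y , y∈ , fy≢0 = y , there y∈ , fy≢0

ind-≢0 : ∀ {P : Set} (P? : Dec P) → ind P? ≢ 0ℚ → P
ind-≢0 (yes p) _  = p
ind-≢0 (no _)  ≢0 = contradiction refl ≢0

one-≢0 : ∀ m → one m ≢ 0ℚ → monomialBlocks m ≡ []
one-≢0 m one≢0 = monomialBlocks-zero 1 (ind-≢0 (All.all? (All.all? (_≟ 0)) m) one≢0)

-- A nonzero coefficient forces the degrees of the variables of f to sum to d and all their
-- exponents to be r. The comparison of Σ d_j² with (Σ d_j)² then gives the bound, and its equality
-- case leaves one variable.
block-≢0 : ∀ {d r} → Positive (d ↑ r) → ∀ f → blockSeries E (d ↑ r) f ≢ 0ℚ →
  squares (monomialBlocks f) ≤ d * d × (squares (monomialBlocks f) ≡ d * d → monomialBlocks f ≡ d ↑ r ∷ [])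
block-≢0 {suc d} {suc r} _ f E≢0 = subst (λ k → squares L ≤ k * k) D≡d (squares≤ L) , only
  where
  L = monomialBlocks f
  product≢0 : ind (totalDegree L ≟ suc d) ⊗ χ (⊝ 1ℚ) (suc r) L ≢ 0ℚ
  product≢0 = E≢0 ∘ trans (E-formula (suc r) (suc d) f)
  D≡d : totalDegree L ≡ suc d
  D≡d = ind-≢0 (totalDegree L ≟ suc d) (⊗-≢0ˡ product≢0)
  sameMultiplicity : All (λ b → multiplicity b ≡ suc r) L
  sameMultiplicity with All.all? (λ b → multiplicity b ≟ suc r) L
  ... | yes p = p
  ... | no ¬p = contradiction (χ-¬all ¬p) (⊗-≢0ʳ product≢0)
  only : squares L ≡ suc d * suc d → L ≡ suc d ↑ suc r ∷ []
  only eq with squares≡ (monomialBlocks-degree 0 f) (λ D≡0 → contradiction (trans (sym D≡d) D≡0) λ ()) (trans eq (cong (λ k → k * k) (sym D≡d)))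
  ... | b , L≡ = trans L≡ (cong (_∷ []) (cong₂ _↑_
    (trans (sym (+-identityʳ (degree b))) (trans (cong totalDegree (sym L≡)) D≡d))
    (All.head (subst (All _) L≡ sameMultiplicity))))

-- Expanding E_L, every block of L picks a set of variables, whose degrees add up
-- to its degree, and the picks cover the monomial; since Σ d² ≤ (Σ d)², the
-- monomial has at most the squares of L, with equality only for disjoint singletons.
blockProduct-≢0 : ∀ {L} → All Positive L → ∀ m → blockProduct E L m ≢ 0ℚ →
  squares (monomialBlocks m) ≤ squares L × (squares (monomialBlocks m) ≡ squares L → monomialBlocks m ↭ L)
blockProduct-≢0 {[]}    []       m ≢0 rewrite one-≢0 m ≢0 = z≤n , λ _ → ↭-refl
blockProduct-≢0 {b ∷ L} (p ∷ ps) m ≢0 with ∑-≢0 (splits m) (≢0 ∘ trans (⊛-∑ (blockSeries E b) (blockProduct E L) m))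
... | (f , g) , fg∈ , term≢0 =
  ≤-trans m≤ (+-mono-≤ f≤ g≤) ,
  λ eq → let m≡ = ≤-antisym m≤ (≤-trans (+-mono-≤ f≤ g≤) (≤-reflexive (sym eq)))
             f≡ , g≡ = +-≡-split f≤ g≤ (trans (sym m≡) eq)
         in ↭-trans (m↭ m≡) (++⁺ (↭-reflexive (f→ f≡)) (g→ g≡))
  where
  open SplitsBlocks (splitsBlocks-monomial 0 m)
  m≤ = proj₁ (shrinks fg∈)
  m↭ = proj₂ (shrinks fg∈)
  f≤ = proj₁ (block-≢0 p f (⊗-≢0ˡ term≢0))
  f→ = proj₂ (block-≢0 p f (⊗-≢0ˡ term≢0))
  g≤ = proj₁ (blockProduct-≢0 ps g (⊗-≢0ʳ term≢0))
  g→ = proj₂ (blockProduct-≢0 ps g (⊗-≢0ʳ term≢0))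

-- Nonvanishing of the diagonal coefficients

opaque
  unfolding _⊕_ _⊗_

  ⊕-nonNeg : ∀ {p q} → 0ℚ ℚ.≤ p → 0ℚ ℚ.≤ q → 0ℚ ℚ.≤ p ⊕ q
  ⊕-nonNeg = ℚ.+-mono-≤

  ⊕-posˡ : ∀ {p q} → 0ℚ ℚ.< p → 0ℚ ℚ.≤ q → 0ℚ ℚ.< p ⊕ q
  ⊕-posˡ = ℚ.+-mono-<-≤

  ⊕-posʳ : ∀ {p q} → 0ℚ ℚ.≤ p → 0ℚ ℚ.< q → 0ℚ ℚ.< p ⊕ q
  ⊕-posʳ = ℚ.+-mono-≤-<

  ⊗-cancelʳ : ∀ {p q} r → r ≢ 0ℚ → p ⊗ r ≡ q ⊗ r → p ≡ q
  ⊗-cancelʳ {p} {q} r r≢0 eq = begin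
    p                        ≡⟨ ℚ.*-identityʳ p ⟨
    p ℚ.* 1ℚ                 ≡⟨ cong (p ℚ.*_) (ℚ.*-inverseʳ r) ⟨
    p ℚ.* (r ℚ.* (ℚ.1/ r))   ≡⟨ ℚ.*-assoc p r _ ⟨
    p ℚ.* r ℚ.* (ℚ.1/ r)     ≡⟨ cong (ℚ._* (ℚ.1/ r)) eq ⟩
    q ℚ.* r ℚ.* (ℚ.1/ r)     ≡⟨ ℚ.*-assoc q r _ ⟩
    q ℚ.* (r ℚ.* (ℚ.1/ r))   ≡⟨ cong (q ℚ.*_) (ℚ.*-inverseʳ r) ⟩
    q ℚ.* 1ℚ                 ≡⟨ ℚ.*-identityʳ q ⟩
    q                        ∎
    where
    open ≡-Reasoning
    instance
      r-nonZero : ℚ.NonZero r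
      r-nonZero = ℚ.≢-nonZero r≢0

∑-nonNeg : ∀ (xs : List A) {f : A → ℚ} → (∀ {x} → x ∈ xs → 0ℚ ℚ.≤ f x) → 0ℚ ℚ.≤ ∑ᵒ xs f
∑-nonNeg []       f≥0 = ℚ.≤-refl
∑-nonNeg (x ∷ xs) f≥0 = ⊕-nonNeg (f≥0 (here refl)) (∑-nonNeg xs (f≥0 ∘ there))

∑-pos : ∀ (xs : List A) {f : A → ℚ} → (∀ {x} → x ∈ xs → 0ℚ ℚ.≤ f x) → ∀ {x} → x ∈ xs → 0ℚ ℚ.< f x → 0ℚ ℚ.< ∑ᵒ xs f
∑-pos (x ∷ xs) f≥0 (here refl) f>0 = ⊕-posˡ f>0 (∑-nonNeg xs (f≥0 ∘ there))
∑-pos (x ∷ xs) f≥0 (there x∈)  f>0 = ⊕-posʳ (f≥0 (here refl)) (∑-pos xs (f≥0 ∘ there) x∈ f>0)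

-- The sign makes the coefficient nonnegative when m and L have equal sums of squares: each block of
-- L then takes a single variable, contributing -1, in every surviving term.
signed : List Block → Monomial → ℚ
signed L m = [-1]^ (length L) ⊗ blockProduct E L m

signed-∷ : ∀ b L m → signed (b ∷ L) m ≡ ∑ᵒ (splits m) (λ (f , g) → ((⊝ 1ℚ) ⊗ blockSeries E b f) ⊗ signed L g)
signed-∷ b L m = begin
  [-1]^ (suc (length L)) ⊗ (blockSeries E b ⊛ᵒ blockProduct E L) m
    ≡⟨ cong₂ _⊗_ ([-1]^-suc (length L)) (⊛-∑ (blockSeries E b) (blockProduct E L) m) ⟩
  ((⊝ 1ℚ) ⊗ [-1]^ (length L)) ⊗ ∑ᵒ (splits m) (λ (f , g) → blockSeries E b f ⊗ blockProduct E L g)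
    ≡⟨ *-∑ _ (splits m) ⟩
  ∑ᵒ (splits m) (λ (f , g) → ((⊝ 1ℚ) ⊗ [-1]^ (length L)) ⊗ (blockSeries E b f ⊗ blockProduct E L g))
    ≡⟨ ∑-cong (splits m) (λ (f , g) → *-interchange (⊝ 1ℚ) _ _ _) ⟩
  ∑ᵒ (splits m) (λ (f , g) → ((⊝ 1ℚ) ⊗ blockSeries E b f) ⊗ signed L g) ∎
  where open ≡-Reasoning

block-single : ∀ {b} → Positive b → ∀ f → monomialBlocks f ≡ b ∷ [] → ∀ q → ((⊝ 1ℚ) ⊗ blockSeries E b f) ⊗ q ≡ q
block-single {d ↑ r@(suc _)} _ f f≡ q = trans (cong (λ x → ((⊝ 1ℚ) ⊗ x) ⊗ q) E≡-1) (trans (cong (_⊗ q) minus-minus) (ℚᵒ.*-identityˡ q))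
  where
  open ≡-Reasoning
  minus-minus : (⊝ 1ℚ) ⊗ (⊝ 1ℚ) ≡ 1ℚ
  minus-minus = trans (-1*x≈-x (⊝ 1ℚ)) (⁻¹-involutive 1ℚ)
  E≡-1 : blockSeries E (d ↑ r) f ≡ ⊝ 1ℚ
  E≡-1 = begin
    blockSeries E (d ↑ r) f
      ≡⟨ E-formula r d f ⟩
    ind (totalDegree (monomialBlocks f) ≟ d) ⊗ χ (⊝ 1ℚ) r (monomialBlocks f)
      ≡⟨ cong (λ L → ind (totalDegree L ≟ d) ⊗ χ (⊝ 1ℚ) r L) f≡ ⟩
    ind (d + 0 ≟ d) ⊗ ((ind (r ≟ r) ⊗ ⊝ 1ℚ) ⊗ 1ℚ)
      ≡⟨ cong₂ _⊗_ (ind-true (d + 0 ≟ d) (+-identityʳ d)) (trans (ℚᵒ.*-identityʳ _) (trans (cong (_⊗ ⊝ 1ℚ) (ind-true (r ≟ r) refl)) (ℚᵒ.*-identityˡ _))) ⟩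
    1ℚ ⊗ ⊝ 1ℚ
      ≡⟨ ℚᵒ.*-identityˡ _ ⟩
    ⊝ 1ℚ ∎

signed-nonNeg : ∀ {L} → All Positive L → ∀ m → squares (monomialBlocks m) ≡ squares L → 0ℚ ℚ.≤ signed L m
signed-term-nonNeg : ∀ {b L} → All Positive (b ∷ L) → ∀ m → squares (monomialBlocks m) ≡ squares (b ∷ L) →
  ∀ {f g} → (f , g) ∈ splits m → 0ℚ ℚ.≤ ((⊝ 1ℚ) ⊗ blockSeries E b f) ⊗ signed L g

signed-nonNeg {[]} [] m _ = subst (0ℚ ℚ.≤_) (sym (ℚᵒ.*-identityˡ (one m))) (one≥0 (All.all? (All.all? (_≟ 0)) m))
  where
  one≥0 : ∀ {P : Set} (P? : Dec P) → 0ℚ ℚ.≤ ind P?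
  one≥0 (yes _) = ℚ.<⇒≤ (ℚ.positive⁻¹ 1ℚ)
  one≥0 (no _)  = ℚ.≤-refl
signed-nonNeg {b ∷ L} ps m eq = subst (0ℚ ℚ.≤_) (sym (signed-∷ b L m)) (∑-nonNeg (splits m) (signed-term-nonNeg ps m eq))

signed-term-nonNeg {b} {L} (p ∷ ps) m eq {f} {g} fg∈ with blockSeries E b f ℚ.≟ 0ℚ | blockProduct E L g ℚ.≟ 0ℚ
... | yes Ef≡0 | _        = ℚ.≤-reflexive (sym (trans (cong (λ x → ((⊝ 1ℚ) ⊗ x) ⊗ signed L g) Ef≡0) (trans (cong (_⊗ signed L g) (ℚᵒ.zeroʳ _)) (ℚᵒ.zeroˡ _))))
... | no _     | yes Eg≡0 = ℚ.≤-reflexive (sym (trans (cong (λ x → ((⊝ 1ℚ) ⊗ blockSeries E b f) ⊗ ([-1]^ (length L) ⊗ x)) Eg≡0) (trans (cong (_ ⊗_) (ℚᵒ.zeroʳ _)) (ℚᵒ.zeroʳ _))))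
... | no Ef≢0  | no Eg≢0  = subst (0ℚ ℚ.≤_) (sym (block-single p f (f→ f≡) (signed L g))) (signed-nonNeg ps g g≡)
  where
  m≤ = proj₁ (SplitsBlocks.shrinks (splitsBlocks-monomial 0 m) fg∈)
  f≤ = proj₁ (block-≢0 p f Ef≢0)
  f→ = proj₂ (block-≢0 p f Ef≢0)
  g≤ = proj₁ (blockProduct-≢0 ps g Eg≢0)
  -- The squares of m are at most those of f and g together, which are at most those of `b ∷ L`. The
  -- two ends agree, so both factors attain their bounds.
  both = +-≡-split f≤ g≤ (≤-antisym (+-mono-≤ f≤ g≤) (≤-trans (≤-reflexive (sym eq)) m≤))
  f≡ = proj₁ both
  g≡ = proj₂ both

-- `extract` provides a splitting of m into the variable of b and a monomial for L; its term is
-- positive by induction, and all other terms are nonnegative.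
signed-pos : ∀ {L} → All Positive L → ∀ m → monomialBlocks m ↭ L → 0ℚ ℚ.< signed L m
signed-pos {[]}    []           m m↭ = subst (0ℚ ℚ.<_) (sym (trans (ℚᵒ.*-identityˡ (one m)) one≡1)) (ℚ.positive⁻¹ 1ℚ)
  where
  one≡1 : one m ≡ 1ℚ
  one≡1 = ind-true (All.all? (All.all? (_≟ 0)) m) (monomialBlocks-zero⁻ 0 m
    (cong totalDegree (↭-empty-inv m↭)))
signed-pos {b ∷ L} all@(p ∷ ps) m m↭
  with SplitsBlocks.extract (splitsBlocks-monomial 0 m) (∈-resp-↭ (↭-sym m↭) (here refl))
... | f , g , fg∈ , f≡ , m↭g = subst (0ℚ ℚ.<_) (sym (signed-∷ b L m))
  (∑-pos (splits m) (signed-term-nonNeg all m (squares-↭ m↭)) fg∈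
    (subst (0ℚ ℚ.<_) (sym (block-single p f f≡ (signed L g))) (signed-pos ps g (drop-∷ (↭-trans (↭-sym m↭g) m↭)))))

-- The fresh variable goes to the front of its row, renumbering the others there, which does not
-- affect the multiset of blocks. Row k, counted from 0, carries degree k + 1.
insertEntry : ℕ → ℕ → Monomial → Monomial
insertEntry zero    r []       = (r ∷ []) ∷ []
insertEntry zero    r (es ∷ m) = (r ∷ es) ∷ m
insertEntry (suc k) r []       = [] ∷ insertEntry k r []
insertEntry (suc k) r (es ∷ m) = es ∷ insertEntry k r m

monomialBlocks-insertEntry : ∀ i k r m → monomialBlocksFrom i (insertEntry k (suc r) m) ↭ (k + i) ↑ suc r ∷ monomialBlocksFrom i m
monomialBlocks-insertEntry i zero    r []       = ↭-refl
monomialBlocks-insertEntry i zero    r (es ∷ m) = ↭-refl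
monomialBlocks-insertEntry i (suc k) r []       =
  subst (λ j → monomialBlocksFrom (suc i) (insertEntry k (suc r) []) ↭ j ↑ suc r ∷ []) (+-suc k i) (monomialBlocks-insertEntry (suc i) k r [])
monomialBlocks-insertEntry i (suc k) r (es ∷ m) = ↭-trans (++⁺ˡ (rowBlocks i es)
  (subst (λ j → monomialBlocksFrom (suc i) (insertEntry k (suc r) m) ↭ j ↑ suc r ∷ monomialBlocksFrom (suc i) m) (+-suc k i) (monomialBlocks-insertEntry (suc i) k r m)))
  (shift ((suc k + i) ↑ suc r) (rowBlocks i es) (monomialBlocksFrom (suc i) m))

monomialOf : ∀ {L} → All Positive L → ∃[ m ] monomialBlocks m ↭ L
monomialOf {[]}                []       = [] , ↭-refl
monomialOf {suc d ↑ suc r ∷ L} (_ ∷ ps) with monomialOf ps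
... | m , m↭L = insertEntry d (suc r) m , ↭-trans (monomialBlocks-insertEntry 1 d r m)
  (subst (λ j → j ↑ suc r ∷ monomialBlocks m ↭ suc d ↑ suc r ∷ L) (sym (+-comm d 1)) (↭.prep _ m↭L))

∑-cancel : ∀ {xs : List A} {x} {f g : A → ℚ} → Unique xs → x ∈ xs → (∀ y → y ≢ x → f y ≡ g y) → ∑ᵒ xs f ≡ ∑ᵒ xs g → f x ≡ g x
∑-cancel {xs = x ∷ xs} {f = f} {g} (x∉ ∷ _) (here refl) f≡g eq =
  ∙-cancelʳ (∑ᵒ xs g) (f x) (g x) (trans (cong (f x ⊕_) (sym (∑-cong-∈ xs λ y∈ → f≡g _ λ { refl → All.lookup x∉ y∈ refl }))) eq)
∑-cancel {xs = y ∷ xs} {f = f} {g} (y∉ ∷ u) (there x∈) f≡g eq =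
  ∑-cancel u x∈ f≡g (∙-cancelˡ (g y) _ _ (trans (cong (_⊕ ∑ᵒ xs f) (sym (f≡g y (All.lookup y∉ x∈)))) eq))

∈⇒≤sum : ∀ {xs x} → x ∈ xs → x ≤ sum xs
∈⇒≤sum {x ∷ xs} (here refl) = m≤m+n x (sum xs)
∈⇒≤sum {y ∷ xs} (there x∈)  = ≤-trans (∈⇒≤sum x∈) (m≤n+m (sum xs) y)

-- Downward induction on the sum of squares: at the monomial of τ, a type ρ other than τ either has
-- coefficient 0 or has larger rank, where the two families are already known to agree. Cancelling
-- these terms leaves the nonzero diagonal one.
independent : ∀ {n} (c c′ : Typ n → ℚ) → linearCombination c (typeSeries E) ≈ linearCombination c′ (typeSeries E) → ∀ τ → c τ ≡ c′ τ
independent {n} c c′ eq τ = go (suc (M ∸ rank τ)) τ ≤-refl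
  where
  rank : Typ n → ℕ
  rank τ = squares (blocks τ)
  -- A crude upper bound on the ranks, which turns downward induction into induction on
  -- `M ∸ rank τ`.
  M = sum (map rank (types n))
  rank≤M : ∀ τ → rank τ ≤ M
  rank≤M τ = ∈⇒≤sum (∈-map⁺ rank (types-complete τ))
  positive : ∀ τ → All Positive (blocks τ)
  positive τ = positive-blocksFrom 1 (factors τ)
  go : ∀ k τ → M ∸ rank τ < k → c τ ≡ c′ τ
  go (suc k) τ (s≤s <k) with monomialOf (positive τ)
  ... | m , m↭τ = ⊗-cancelʳ (S τ) Sτ≢0 (∑-cancel (types-unique n) (types-complete τ) others
    (trans (sym (linearCombination≡ c (typeSeries E) m)) (trans (eq m) (linearCombination≡ c′ (typeSeries E) m))))
    where
    S : Typ n → ℚ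
    S ρ = typeSeries E ρ m
    S≡ : ∀ ρ → S ρ ≡ blockProduct E (blocks ρ) m
    S≡ ρ = cong (λ F → F m) (typeSeries≡ E ρ)
    Sτ≢0 : S τ ≢ 0ℚ
    Sτ≢0 S≡0 = ℚ.<⇒≢ (signed-pos (positive τ) m m↭τ)
      (sym (trans (cong ([-1]^ (length (blocks τ)) ⊗_) (trans (sym (S≡ τ)) S≡0)) (ℚᵒ.zeroʳ _)))
    others : ∀ ρ → ρ ≢ τ → c ρ ⊗ S ρ ≡ c′ ρ ⊗ S ρ
    others ρ ρ≢τ with S ρ ℚ.≟ 0ℚ
    ... | yes S≡0 = trans (cong (c ρ ⊗_) S≡0) (trans (ℚᵒ.zeroʳ _) (sym (trans (cong (c′ ρ ⊗_) S≡0) (ℚᵒ.zeroʳ _))))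
    ... | no S≢0 = cong (_⊗ S ρ) (go k ρ (<-≤-trans (∸-monoʳ-< τ<ρ (rank≤M ρ)) <k))
      where
      bound = blockProduct-≢0 (positive ρ) m (S≢0 ∘ trans (S≡ ρ))
      τ<ρ : rank τ < rank ρ
      τ<ρ = ≤∧≢⇒< (≤-trans (≤-reflexive (sym (squares-↭ m↭τ))) (proj₁ bound)) λ τ≡ρ →
        ρ≢τ (blocks-injective {σ = ρ} {τ} (↭-trans (↭-sym (proj₂ bound (trans (squares-↭ m↭τ) τ≡ρ))) m↭τ))

theorem43 : (n : ℕ) (σ τ : Typ n) → IsCoefficient (typeSeries E) τ (typeSeries E⁺ σ) (∑ (PTdoub σ τ) (λ T → [-1]^ (ℓ₁ σ T)))
theorem43 n σ τ = (tabloidSum σ , expansion σ) ,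
  λ c σ≈c → independent c (tabloidSum σ) (≈-trans (≈-sym σ≈c) (expansion σ)) τ
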